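{- There exist constants $c_0>c_1>1$ and $\Delta_0$ such that for all integers $\Delta\ge\Delta_0$ and $n\ge (c_0)^{2\Delta}$ there exists a bipartite graph $H$ with vertex classes $X$ and $Y$, each of size $n$, and maximum degree at most $\Delta$, such that the following hold, where $k=\lfloor (c_0)^{\Delta}\rfloor$. 1. For all partitions $X=X_1\cup\dots\cup X_k\cup D_X$ and $Y=Y_1\cup\dots\cup Y_k\cup D_Y$ with $|X_i|,|Y_i|\le (c_1/c_0)^{\Delta}n$ for all $i$ and $|D_X|,|D_Y|\le 0.02n$, we have $$\sum_{i\ne j:\ e_H(X_i,Y_j)>0}|X_i||Y_j|>0.55(0.98n)^2.$$ 2. For all $X'\subseteq X$ and $Y'\subseteq Y$ such that $|X'|,|Y'|\ge 0.01n$, we have $e_H(X',Y')>0$.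
   Context: For sets $X',Y'$ of vertices, $e_H(X',Y')$ denotes the number of pairs in $X'\times Y'$ that are edges of $H$. Partitions are into disjoint, possibly empty, parts. The sum in item 1 is over ordered pairs $(i,j)\in\{1,\dots,k\}^2$ with $i\neq j$ and $e_H(X_i,Y_j)>0$. -}

module Defs where

open import Data.Bool.Base using (Bool)
open import Data.Bool.Properties using (T?)
open import Data.Fin.Base using (Fin)
open import Data.Fin.Properties using () renaming (_≟_ to _≟ᶠ_)
open import Data.Fin.Subset using (Subset; _∈_; _∩_; ∣_∣; Empty)
open import Data.Fin.Subset.Properties using (_∈?_)
open import Data.Integer.Base as ℤ using (+_)
open import Data.List.Base using (map; filter; length; allFin; cartesianProduct; _++_)
open import Data.List.Extrema.Nat using (max)
open import Data.Nat.Base as ℕ using (ℕ)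
open import Data.Nat.ListAction using (sum)
open import Data.Nat.Properties as ℕ using ()
open import Data.Product.Base using (_×_; _,_; ∃-syntax)
open import Data.Rational.Base using (ℚ; 0ℚ; 1ℚ; _/_; _<_; floor; NonZero; >-nonZero; +-*-rawSemiring)
open import Data.Rational.Properties as ℚ using (<-trans)
open import Data.Sum.Base using (_⊎_)
open import Relation.Binary.PropositionalEquality using (_≢_)
open import Relation.Nullary.Decidable using (¬?; _×-dec_; toWitness)

open import Algebra.Definitions.RawSemiring +-*-rawSemiring public using (_^_)

fromℕ : ℕ → ℚ
fromℕ m = + m / 1

-- For p ≥ 0 this is ⌊ p ⌋; it is only applied to powers of a number exceeding 1.
⌊_⌋ℕ : ℚ → ℕ
⌊ p ⌋ℕ = ℤ.∣ floor p ∣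

1<p<q⇒q-nonZero : ∀ {p q} → 1ℚ < p → p < q → NonZero q
1<p<q⇒q-nonZero 1<p p<q =
  >-nonZero (<-trans (toWitness {a? = 0ℚ ℚ.<? 1ℚ} _) (<-trans 1<p p<q))

-- The vertex classes are X = Fin m and Y = Fin n, regarded as disjoint sets;
-- the edges are the pairs (x , y) with H x y true.
BipartiteGraph : ℕ → ℕ → Set
BipartiteGraph m n = Fin m → Fin n → Bool

module _ {m n : ℕ} (H : BipartiteGraph m n) where

  degreeX : Fin m → ℕ
  degreeX x = length (filter (λ y → T? (H x y)) (allFin n))

  degreeY : Fin n → ℕ
  degreeY y = length (filter (λ x → T? (H x y)) (allFin m))

  maxDegree : ℕ
  maxDegree = max 0 (map degreeX (allFin m) ++ map degreeY (allFin n))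

  e : Subset m → Subset n → ℕ
  e X′ Y′ = length (filter (λ (x , y) → x ∈? X′ ×-dec y ∈? Y′ ×-dec T? (H x y))
                           (cartesianProduct (allFin m) (allFin n)))

-- Parts may be empty.
record Partition (k n : ℕ) : Set where
  field
    part            : Fin k → Subset n
    D               : Subset n
    parts-disjoint  : ∀ i j → i ≢ j → Empty (part i ∩ part j)
    D-disjoint      : ∀ i → Empty (part i ∩ D)
    covers          : ∀ x → (∃[ i ] x ∈ part i) ⊎ x ∈ D

open Partition public

crossSum : ∀ {k m n} → BipartiteGraph m n → Partition k m → Partition k n → ℕ
crossSum {k} H 𝒳 𝒴 =
  sum (map (λ (i , j) → ∣ part 𝒳 i ∣ ℕ.* ∣ part 𝒴 j ∣)
           (filter (λ (i , j) → ¬? (i ≟ᶠ j) ×-dec 0 ℕ.<? e H (part 𝒳 i) (part 𝒴 j))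
                   (cartesianProduct (allFin k) (allFin k))))

{-# OPTIONS --safe #-}
module Submission where

-- Call F ⊆ X × Y large if |F| ≥ n²/c with c = 10000.  H is built greedily so as to meet every large
-- union of blocks a⁻¹(i) × b⁻¹(j), where a, b : [n] → [k + 1] are arbitrary labelings.  There are at
-- most (k + 1)²ⁿ 2^((k + 1)²) ≤ (64 k²)ⁿ such unions, as k² ≤ c₀^(2Δ) ≤ n.  As long as at most
-- nΔ/(4c) edges have been placed, at most n/(4c) vertices on either side have degree Δ, so a large F
-- keeps at least n²/(2c) cells avoiding them; by averaging, some admissible cell lies in a fraction
-- 1/(2c) of all large unions not met so far.  Adding about nΔ/(4c) edges leaves at most
-- (64 k² (1 - 1/(2c))^(Δ/(4c)))ⁿ < 1 of them, provided that c₀ is close enough to 1.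
--
-- Item 2 follows by applying this to X′ × Y′.  For item 1, take the union of the X_i × Y_j without
-- edges: H misses it, so it is not large; the cells with i = j and those meeting D_X or D_Y are few,
-- hence the remaining pairs carry at least 0.9n².

open import Defs
open import Data.Fin.Subset using (Subset; ∣_∣)
open import Data.Integer.Base using (+_)
open import Data.Nat.Base as ℕ using (ℕ)
open import Data.Product.Base using (Σ-syntax; _×_)
open import Data.Rational.Base using (ℚ; 1ℚ)

module Proof where

  open import Data.Bool.Base using (Bool; true; false; T; not; if_then_else_; _∧_; _∨_)
  open import Data.Bool.Properties using (T?; T-∧; T-∨)
  open import Data.Fin.Base using (Fin; zero; suc)
  open import Data.Fin.Properties using (any?) renaming (_≟_ to _≟ᶠ_)
  open import Data.Fin.Subset using (_∈_)
  open import Data.Fin.Subset.Properties using (_∈?_)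
  open import Data.Integer.Base as ℤ using (-[1+_]; +≤+)
  import Data.Integer.Properties as ℤ
  open import Data.List.Base
    using (List; []; _∷_; _++_; map; length; filterᵇ; filter; tabulate; allFin; cartesianProduct; cartesianProductWith)
  open import Data.List.Extrema.Nat using (max≤v⁺)
  open import Data.List.Membership.Propositional using () renaming (_∈_ to _∈ˡ_)
  open import Data.List.Membership.Propositional.Properties
    using (∈-cartesianProductWith⁺; ∈-cartesianProduct⁺; ∈-filter⁺; ∈-allFin; ∈-length)
  open import Data.List.Properties using (length-map; length-++; length-filter; length-tabulate; map-tabulate; map-++)
  open import Data.List.Relation.Unary.All as All using (All; []; _∷_)
  open import Data.List.Relation.Unary.All.Properties using (all-filter; ++⁺; map⁺; tabulate⁺)
  open import Data.List.Relation.Unary.Any using (here; there)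
  open import Data.Nat.Base using (zero; suc; _+_; _*_; _∸_; _/_; _≤_; _<_; _>_; _<ᵇ_; z≤n; s≤s; z<s; NonZero; >-nonZero)
    renaming (_^_ to _^ℕ_)
  open import Data.Nat.Coprimality using (1-coprimeTo) renaming (sym to coprime-sym)
  open import Data.Nat.DivMod using (m/n*n≤m; m≥n⇒m/n>0; m*n/n≡m; /-monoˡ-≤; m≡m%n+[m/n]*n; m%n<n)
  open import Data.Nat.ListAction using () renaming (sum to sumˡ)
  open import Data.Nat.ListAction.Properties using (sum-++)
  open import Data.Nat.Properties
  open import Algebra.Properties.Semiring.Sum +-*-semiring
    using (sum; sum-syntax; sum-cong-≗; ∑-distrib-+; ∑-comm; *-distribˡ-sum; *-distribʳ-sum)
  open import Data.Nat.Tactic.RingSolver using (solve-∀)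
  open import Data.Product.Base using (∃-syntax; _,_; proj₁; proj₂; map₂)
  open import Data.Rational.Base as ℚ using (mkℚ; toℚᵘ; Positive; NonNegative; *≤*)
  import Data.Rational.Properties as ℚ
  open import Data.Rational.Solver using (module +-*-Solver)
  open import Data.Rational.Unnormalised.Base as ℚᵘ using (mkℚᵘ; *≡*)
  import Data.Rational.Unnormalised.Properties as ℚᵘ
  open import Data.Sum.Base using (_⊎_; inj₁; inj₂)
  open import Data.Unit.Base using (tt)
  open import Data.Vec.Base as Vec using (Vec; []; _∷_; lookup)
  open import Data.Vec.Properties using (lookup∘tabulate; []=⇒lookup; lookup⇒[]=)
  open import Function.Base using (_∘_)
  open import Function.Bundles using (Equivalence)
  open import Relation.Binary.PropositionalEquality
    using (_≡_; refl; sym; trans; cong; cong₂; subst; subst₂; module ≡-Reasoning)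
  open import Relation.Nullary.Decidable using (Dec; does; yes; no; toWitness; ¬?; _×-dec_)
  open import Relation.Nullary.Negation using (contradiction; ¬_)
  open import Relation.Unary using (Decidable)

  -- Double sums over Fin

  𝟙 : Bool → ℕ
  𝟙 b = if b then 1 else 0

  sum-mono-≤ : ∀ {n} {f g : Fin n → ℕ} → (∀ i → f i ≤ g i) → sum f ≤ sum g
  sum-mono-≤ {zero}  f≤g = z≤n
  sum-mono-≤ {suc n} f≤g = +-mono-≤ (f≤g zero) (sum-mono-≤ (f≤g ∘ suc))

  sum-const : ∀ n a → ∑[ i < n ] a ≡ n * a
  sum-const zero    a = refl
  sum-const (suc n) a = cong₂ _+_ refl (sum-const n a)

  ≤-average : ∀ {n} a (f : Fin n → ℕ) → 0 < n → n * a ≤ sum f → ∃[ i ] a ≤ f i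
  ≤-average {n} a f 0<n na≤∑ with any? (λ i → a ≤? f i)
  ... | yes ∃i = ∃i
  ... | no ¬∃i = contradiction
    (begin-strict
      n * a ≤⟨ na≤∑ ⟩
      sum f <⟨ m<m+n (sum f) 0<n ⟩
      sum f + n ≡⟨ +-comm (sum f) n ⟩
      n + sum f ≡⟨ cong (_+ sum f) (trans (sum-const n 1) (*-identityʳ n)) ⟨
      ∑[ i < n ] 1 + sum f ≡⟨ ∑-distrib-+ (λ _ → 1) f ⟨
      ∑[ i < n ] suc (f i) ≤⟨ sum-mono-≤ (λ i → ≰⇒> (λ a≤fi → ¬∃i (i , a≤fi))) ⟩
      ∑[ i < n ] a ≡⟨ sum-const n a ⟩
      n * a ∎)
    (<-irrefl refl)
    where open ≤-Reasoning

  ≤-average₂ : ∀ {m n} a (f : Fin m → Fin n → ℕ) → 0 < m → 0 < n →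
               m * n * a ≤ ∑[ i < m ] sum (f i) → ∃[ i ] ∃[ j ] a ≤ f i j
  ≤-average₂ {m} {n} a f 0<m 0<n le
    with ≤-average (n * a) (sum ∘ f) 0<m (≤-trans (≤-reflexive (sym (*-assoc m n a))) le)
  ... | i , na≤ with ≤-average a (f i) 0<n na≤
  ...   | j , a≤ = i , j , a≤

  ∑-δ : ∀ {n} (u : Fin n) (g : Fin n → ℕ) → ∑[ x < n ] (𝟙 (does (u ≟ᶠ x)) * g x) ≡ g u
  ∑-δ {suc n} zero g = trans (cong₂ _+_ (+-identityʳ (g zero)) (trans (sum-const n 0) (*-zeroʳ n)))
                             (+-identityʳ (g zero))
  ∑-δ {suc n} (suc u) g = ∑-δ u (g ∘ suc)

  ∑-δ-1 : ∀ {n} (u : Fin n) → ∑[ x < n ] 𝟙 (does (u ≟ᶠ x)) ≡ 1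
  ∑-δ-1 u = trans (sum-cong-≗ (λ x → sym (*-identityʳ (𝟙 (does (u ≟ᶠ x)))))) (∑-δ u (λ _ → 1))

  ∑∑ : ∀ {m n} → (Fin m → Fin n → ℕ) → ℕ
  ∑∑ {m} f = ∑[ i < m ] sum (f i)

  ∑∑-mono-≤ : ∀ {m n} {f g : Fin m → Fin n → ℕ} → (∀ i j → f i j ≤ g i j) → ∑∑ f ≤ ∑∑ g
  ∑∑-mono-≤ f≤g = sum-mono-≤ (λ i → sum-mono-≤ (f≤g i))

  ∑∑-distrib-+ : ∀ {m n} (f g : Fin m → Fin n → ℕ) → ∑∑ (λ i j → f i j + g i j) ≡ ∑∑ f + ∑∑ g
  ∑∑-distrib-+ f g = trans (sum-cong-≗ (λ i → ∑-distrib-+ (f i) (g i))) (∑-distrib-+ (sum ∘ f) (sum ∘ g))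

  ∑∑-*ˡ : ∀ {m n} a (f : Fin m → Fin n → ℕ) → a * ∑∑ f ≡ ∑∑ (λ i j → a * f i j)
  ∑∑-*ˡ a f = trans (*-distribˡ-sum a (sum ∘ f)) (sum-cong-≗ (λ i → *-distribˡ-sum a (f i)))

  ∑∑-row : ∀ {m n} (f : Fin m → ℕ) → ∑∑ {m} {n} (λ i _ → f i) ≡ n * sum f
  ∑∑-row {m} {n} f = trans (sum-cong-≗ (λ i → sum-const n (f i))) (sym (*-distribˡ-sum n f))

  ∑∑-column : ∀ {m n} (f : Fin n → ℕ) → ∑∑ {m} {n} (λ _ j → f j) ≡ m * sum f
  ∑∑-column {m} f = sum-const m (sum f)

  occ : ∀ {n} → List (Fin n) → Fin n → ℕ
  occ []       x = 0
  occ (u ∷ us) x = 𝟙 (does (u ≟ᶠ x)) + occ us x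

  ∑-occ : ∀ {n} (us : List (Fin n)) → sum (occ us) ≡ length us
  ∑-occ {n} []       = trans (sum-const n 0) (*-zeroʳ n)
  ∑-occ     (u ∷ us) = trans (∑-distrib-+ (λ x → 𝟙 (does (u ≟ᶠ x))) (occ us))
                             (cong₂ _+_ (∑-δ-1 u) (∑-occ us))

  area : ∀ {n} → BipartiteGraph n n → ℕ
  area F = ∑∑ (λ x y → 𝟙 (F x y))

  Edges : ℕ → Set
  Edges n = List (Fin n × Fin n)

  -- The list may repeat an edge, so occ only bounds the degrees from above.
  graph : ∀ {n} → Edges n → BipartiteGraph n n
  graph []            x y = false
  graph ((u , v) ∷ E) x y = does (u ≟ᶠ x) ∧ does (v ≟ᶠ y) ∨ graph E x y

  𝟙-∨ : ∀ a b → 𝟙 (a ∨ b) ≤ 𝟙 a + 𝟙 b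
  𝟙-∨ true  b = s≤s z≤n
  𝟙-∨ false b = ≤-refl

  𝟙-∧ : ∀ a b → 𝟙 (a ∧ b) ≡ 𝟙 a * 𝟙 b
  𝟙-∧ true  b = sym (+-identityʳ (𝟙 b))
  𝟙-∧ false b = refl

  ∑-graph-row : ∀ {n} (E : Edges n) x → ∑[ y < n ] 𝟙 (graph E x y) ≤ occ (map proj₁ E) x
  ∑-graph-row {n} [] x = ≤-reflexive (trans (sum-const n 0) (*-zeroʳ n))
  ∑-graph-row {n} ((u , v) ∷ E) x = begin
    ∑[ y < n ] 𝟙 (does (u ≟ᶠ x) ∧ does (v ≟ᶠ y) ∨ graph E x y)
      ≤⟨ sum-mono-≤ (λ y → 𝟙-∨ (does (u ≟ᶠ x) ∧ does (v ≟ᶠ y)) _) ⟩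
    ∑[ y < n ] (𝟙 (does (u ≟ᶠ x) ∧ does (v ≟ᶠ y)) + 𝟙 (graph E x y))
      ≡⟨ ∑-distrib-+ (λ y → 𝟙 (does (u ≟ᶠ x) ∧ does (v ≟ᶠ y))) _ ⟩
    ∑[ y < n ] 𝟙 (does (u ≟ᶠ x) ∧ does (v ≟ᶠ y)) + ∑[ y < n ] 𝟙 (graph E x y)
      ≡⟨ cong (_+ ∑[ y < n ] 𝟙 (graph E x y)) (sum-cong-≗ (λ y → 𝟙-∧ (does (u ≟ᶠ x)) (does (v ≟ᶠ y)))) ⟩
    ∑[ y < n ] (𝟙 (does (u ≟ᶠ x)) * 𝟙 (does (v ≟ᶠ y))) + ∑[ y < n ] 𝟙 (graph E x y)
      ≡⟨ cong (_+ ∑[ y < n ] 𝟙 (graph E x y)) (*-distribˡ-sum (𝟙 (does (u ≟ᶠ x))) (λ y → 𝟙 (does (v ≟ᶠ y)))) ⟨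
    𝟙 (does (u ≟ᶠ x)) * (∑[ y < n ] 𝟙 (does (v ≟ᶠ y))) + ∑[ y < n ] 𝟙 (graph E x y)
      ≡⟨ cong (λ s → 𝟙 (does (u ≟ᶠ x)) * s + _) (∑-δ-1 v) ⟩
    𝟙 (does (u ≟ᶠ x)) * 1 + ∑[ y < n ] 𝟙 (graph E x y)
      ≤⟨ +-mono-≤ (≤-reflexive (*-identityʳ _)) (∑-graph-row E x) ⟩
    𝟙 (does (u ≟ᶠ x)) + occ (map proj₁ E) x ∎
    where open ≤-Reasoning

  ∑-graph-column : ∀ {n} (E : Edges n) y → ∑[ x < n ] 𝟙 (graph E x y) ≤ occ (map proj₂ E) y
  ∑-graph-column {n} [] y = ≤-reflexive (trans (sum-const n 0) (*-zeroʳ n))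
  ∑-graph-column {n} ((u , v) ∷ E) y = begin
    ∑[ x < n ] 𝟙 (does (u ≟ᶠ x) ∧ does (v ≟ᶠ y) ∨ graph E x y)
      ≤⟨ sum-mono-≤ (λ x → 𝟙-∨ (does (u ≟ᶠ x) ∧ does (v ≟ᶠ y)) _) ⟩
    ∑[ x < n ] (𝟙 (does (u ≟ᶠ x) ∧ does (v ≟ᶠ y)) + 𝟙 (graph E x y))
      ≡⟨ ∑-distrib-+ (λ x → 𝟙 (does (u ≟ᶠ x) ∧ does (v ≟ᶠ y))) _ ⟩
    ∑[ x < n ] 𝟙 (does (u ≟ᶠ x) ∧ does (v ≟ᶠ y)) + ∑[ x < n ] 𝟙 (graph E x y)
      ≡⟨ cong (_+ ∑[ x < n ] 𝟙 (graph E x y)) (sum-cong-≗ (λ x → 𝟙-∧ (does (u ≟ᶠ x)) (does (v ≟ᶠ y)))) ⟩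
    ∑[ x < n ] (𝟙 (does (u ≟ᶠ x)) * 𝟙 (does (v ≟ᶠ y))) + ∑[ x < n ] 𝟙 (graph E x y)
      ≡⟨ cong (_+ ∑[ x < n ] 𝟙 (graph E x y)) (∑-δ u (λ _ → 𝟙 (does (v ≟ᶠ y)))) ⟩
    𝟙 (does (v ≟ᶠ y)) + ∑[ x < n ] 𝟙 (graph E x y)
      ≤⟨ +-monoʳ-≤ (𝟙 (does (v ≟ᶠ y))) (∑-graph-column E y) ⟩
    𝟙 (does (v ≟ᶠ y)) + occ (map proj₂ E) y ∎
    where open ≤-Reasoning

  Hits : ∀ {n} → BipartiteGraph n n → BipartiteGraph n n → Set
  Hits H F = ∃[ x ] ∃[ y ] T (H x y) × T (F x y)

  T-≟-refl : ∀ {n} (u : Fin n) → T (does (u ≟ᶠ u))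
  T-≟-refl zero    = tt
  T-≟-refl (suc u) = T-≟-refl u

  0<𝟙+m : ∀ a {m} → 0 < 𝟙 a + m → T a ⊎ 0 < m
  0<𝟙+m true  _   = inj₁ tt
  0<𝟙+m false pos = inj₂ pos

  -- The greedy choice of edges

  module Greedy {n : ℕ} (0<n : 0 < n) (c Δ : ℕ) .{{_ : NonZero Δ}} where

    open ≤-Reasoning

    unsaturated : List (Fin n) → Fin n → Bool
    unsaturated us x = occ us x <ᵇ Δ

    saturatedCount : List (Fin n) → ℕ
    saturatedCount us = ∑[ x < n ] 𝟙 (not (unsaturated us x))

    allowed : Edges n → BipartiteGraph n n → BipartiteGraph n n
    allowed E F x y = F x y ∧ unsaturated (map proj₁ E) x ∧ unsaturated (map proj₂ E) y

    Bounded : Edges n → Set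
    Bounded E = (∀ x → occ (map proj₁ E) x ≤ Δ) × (∀ y → occ (map proj₂ E) y ≤ Δ)

    Large : BipartiteGraph n n → Set
    Large F = n * n ≤ c * area F

    saturated-bound : ∀ us → saturatedCount us * Δ ≤ length us
    saturated-bound us = begin
      saturatedCount us * Δ ≡⟨ *-distribʳ-sum Δ (λ x → 𝟙 (not (unsaturated us x))) ⟩
      ∑[ x < n ] (𝟙 (not (unsaturated us x)) * Δ) ≤⟨ sum-mono-≤ pointwise ⟩
      sum (occ us) ≡⟨ ∑-occ us ⟩
      length us ∎
      where
      pointwise : ∀ x → 𝟙 (not (unsaturated us x)) * Δ ≤ occ us x
      pointwise x with occ us x <ᵇ Δ in eq
      ... | true  = z≤n
      ... | false = ≤-trans (≤-reflexive (+-identityʳ Δ)) (≮⇒≥ (λ o<Δ → subst T eq (<⇒<ᵇ o<Δ)))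

    occ-∷-bound : ∀ us u → (∀ x → occ us x ≤ Δ) → T (unsaturated us u) → ∀ x → occ (u ∷ us) x ≤ Δ
    occ-∷-bound us u bound open-u x with u ≟ᶠ x
    ... | no _ = bound x
    ... | yes refl = <ᵇ⇒< (occ us u) Δ open-u

    area-allowed : ∀ E F →
      area F ≤ area (allowed E F) + n * (saturatedCount (map proj₁ E) + saturatedCount (map proj₂ E))
    area-allowed E F = begin
      area F
        ≤⟨ ∑∑-mono-≤ (λ x y → pointwise (F x y) (unsaturated us x) (unsaturated vs y)) ⟩
      ∑∑ (λ x y → 𝟙 (allowed E F x y) + (𝟙 (not (unsaturated us x)) + 𝟙 (not (unsaturated vs y))))
        ≡⟨ ∑∑-distrib-+ (λ x y → 𝟙 (allowed E F x y)) _ ⟩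
      area (allowed E F) + ∑∑ (λ x y → 𝟙 (not (unsaturated us x)) + 𝟙 (not (unsaturated vs y)))
        ≡⟨ cong₂ _+_ (refl {x = area (allowed E F)})
             (trans (∑∑-distrib-+ (λ x y → 𝟙 (not (unsaturated us x))) (λ x y → 𝟙 (not (unsaturated vs y))))
               (trans (cong₂ _+_ (∑∑-row {n} {n} (λ x → 𝟙 (not (unsaturated us x))))
                                 (∑∑-column {n} {n} (λ y → 𝟙 (not (unsaturated vs y)))))
                 (sym (*-distribˡ-+ n (saturatedCount us) (saturatedCount vs))))) ⟩
      area (allowed E F) + n * (saturatedCount us + saturatedCount vs) ∎
      where
      us = map proj₁ E
      vs = map proj₂ E
      pointwise : ∀ a b d → 𝟙 a ≤ 𝟙 (a ∧ b ∧ d) + (𝟙 (not b) + 𝟙 (not d))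
      pointwise false b     d     = z≤n
      pointwise true  false d     = s≤s z≤n
      pointwise true  true  false = s≤s z≤n
      pointwise true  true  true  = s≤s z≤n

    module _ (s : ℕ) (sc≤Δ : s * (4 * c) ≤ Δ) where

      saturated-few : ∀ us → length us ≤ s * n → 4 * c * saturatedCount us ≤ n
      saturated-few us len = *-cancelʳ-≤ _ _ Δ (begin
        4 * c * saturatedCount us * Δ ≡⟨ *-assoc (4 * c) (saturatedCount us) Δ ⟩
        4 * c * (saturatedCount us * Δ) ≤⟨ *-monoʳ-≤ (4 * c) (≤-trans (saturated-bound us) len) ⟩
        4 * c * (s * n) ≡⟨ solve c s n ⟩
        s * (4 * c) * n ≤⟨ *-monoˡ-≤ n sc≤Δ ⟩
        Δ * n ≡⟨ *-comm Δ n ⟩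
        n * Δ ∎)
        where
        solve : ∀ c s n → 4 * c * (s * n) ≡ s * (4 * c) * n
        solve = solve-∀

      large-allowed : ∀ E F → length E ≤ s * n → Large F → n * n ≤ 2 * c * area (allowed E F)
      large-allowed E F len large = *-cancelˡ-≤ 2 (+-cancelʳ-≤ (n * n + n * n) _ _ (begin
        2 * (n * n) + (n * n + n * n) ≡⟨ eq₁ (n * n) ⟩
        4 * (n * n) ≤⟨ *-monoʳ-≤ 4 large ⟩
        4 * (c * area F) ≡⟨ *-assoc 4 c (area F) ⟨
        4 * c * area F ≤⟨ *-monoʳ-≤ (4 * c) (area-allowed E F) ⟩
        4 * c * (A + n * (a + b)) ≡⟨ eq₂ c A n a b ⟩
        2 * (2 * c * A) + (n * (4 * c * a) + n * (4 * c * b))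
          ≤⟨ +-monoʳ-≤ (2 * (2 * c * A))
               (+-mono-≤ (*-monoʳ-≤ n (saturated-few us (≤-trans (≤-reflexive (length-map proj₁ E)) len)))
                         (*-monoʳ-≤ n (saturated-few vs (≤-trans (≤-reflexive (length-map proj₂ E)) len)))) ⟩
        2 * (2 * c * A) + (n * n + n * n) ∎))
        where
        us = map proj₁ E
        vs = map proj₂ E
        A = area (allowed E F)
        a = saturatedCount us
        b = saturatedCount vs
        eq₁ : ∀ z → 2 * z + (z + z) ≡ 4 * z
        eq₁ = solve-∀
        eq₂ : ∀ c A n a b → 4 * c * (A + n * (a + b)) ≡ 2 * (2 * c * A) + (n * (4 * c * a) + n * (4 * c * b))
        eq₂ = solve-∀

      hitCount : Edges n → List (BipartiteGraph n n) → Fin n → Fin n → ℕ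
      hitCount E []       x y = 0
      hitCount E (F ∷ Fs) x y = 𝟙 (allowed E F x y) + hitCount E Fs x y

      ∑∑-hitCount : ∀ E Fs → length E ≤ s * n → All Large Fs →
                    n * n * length Fs ≤ 2 * c * ∑∑ (hitCount E Fs)
      ∑∑-hitCount E [] len [] = ≤-trans (≤-reflexive (*-zeroʳ (n * n))) z≤n
      ∑∑-hitCount E (F ∷ Fs) len (large ∷ larges) = begin
        n * n * suc (length Fs) ≡⟨ *-suc (n * n) (length Fs) ⟩
        n * n + n * n * length Fs ≤⟨ +-mono-≤ (large-allowed E F len large) (∑∑-hitCount E Fs len larges) ⟩
        2 * c * area (allowed E F) + 2 * c * ∑∑ (hitCount E Fs) ≡⟨ *-distribˡ-+ (2 * c) _ _ ⟨
        2 * c * (area (allowed E F) + ∑∑ (hitCount E Fs))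
          ≡⟨ cong (2 * c *_) (∑∑-distrib-+ (λ x y → 𝟙 (allowed E F x y)) (hitCount E Fs)) ⟨
        2 * c * ∑∑ (hitCount E (F ∷ Fs)) ∎

      good-cell : ∀ E Fs → length E ≤ s * n → All Large Fs →
                  ∃[ x ] ∃[ y ] length Fs ≤ 2 * c * hitCount E Fs x y
      good-cell E Fs len larges = ≤-average₂ (length Fs) (λ x y → 2 * c * hitCount E Fs x y) 0<n 0<n
        (≤-trans (∑∑-hitCount E Fs len larges) (≤-reflexive (∑∑-*ˡ (2 * c) (hitCount E Fs))))

      hit-unsaturated : ∀ E Fs x y → 0 < hitCount E Fs x y →
                        T (unsaturated (map proj₁ E) x) × T (unsaturated (map proj₂ E) y)
      hit-unsaturated E (F ∷ Fs) x y pos with 0<𝟙+m (allowed E F x y) pos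
      ... | inj₁ hit  = Equivalence.to T-∧ (proj₂ (Equivalence.to (T-∧ {F x y}) hit))
      ... | inj₂ pos′ = hit-unsaturated E Fs x y pos′

      survivors : Edges n → List (BipartiteGraph n n) → Fin n → Fin n → List (BipartiteGraph n n)
      survivors E Fs x y = filterᵇ (λ F → not (allowed E F x y)) Fs

      length-survivors : ∀ E Fs x y → length (survivors E Fs x y) + hitCount E Fs x y ≡ length Fs
      length-survivors E []       x y = refl
      length-survivors E (F ∷ Fs) x y with allowed E F x y
      ... | true  = trans (+-suc _ _) (cong suc (length-survivors E Fs x y))
      ... | false = cong suc (length-survivors E Fs x y)

      large-survivors : ∀ E Fs x y → All Large Fs → All Large (survivors E Fs x y)
      large-survivors E []       x y [] = []
      large-survivors E (F ∷ Fs) x y (large ∷ larges) with allowed E F x y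
      ... | true  = large-survivors E Fs x y larges
      ... | false = large ∷ large-survivors E Fs x y larges

      hits-survivors : ∀ E Fs x y H → T (H x y) → All (Hits H) (survivors E Fs x y) → All (Hits H) Fs
      hits-survivors E []       x y H Hxy [] = []
      hits-survivors E (F ∷ Fs) x y H Hxy hits with allowed E F x y in eq
      ... | true  = (x , y , Hxy , proj₁ (Equivalence.to T-∧ (subst T (sym eq) tt))) ∷ hits-survivors E Fs x y H Hxy hits
      hits-survivors E (F ∷ Fs) x y H Hxy (hit ∷ hits) | false =
        hit ∷ hits-survivors E Fs x y H Hxy hits

      greedy : ∀ r → 2 * c ≡ suc r → ∀ t E Fs → length E + t ≤ s * n → Bounded E → All Large Fs →
               length Fs * r ^ℕ t < suc r ^ℕ t →
               Σ[ E′ ∈ Edges n ] Bounded E′ × (∀ x y → T (graph E x y) → T (graph E′ x y))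
                 × All (Hits (graph E′)) Fs
      greedy r 2c≡1+r t E [] _ bounded _ _ = E , bounded , (λ _ _ → λ z → z) , []
      greedy r 2c≡1+r zero E (F ∷ Fs) _ _ _ (s≤s ())
      greedy r 2c≡1+r (suc t) E Fs@(_ ∷ _) len bounded larges few
        with good-cell E Fs (≤-trans (m≤m+n _ _) len) larges
      ... | x , y , le
        with hit-unsaturated E Fs x y (n≢0⇒n>0 (λ h≡0 →
               contradiction (≤-trans le (≤-reflexive (trans (cong (2 * c *_) h≡0) (*-zeroʳ (2 * c))))) λ ()))
      ... | openˣ , openʸ
        with greedy r 2c≡1+r t ((x , y) ∷ E) (survivors E Fs x y)
               (≤-trans (≤-reflexive (sym (+-suc (length E) t))) len)
               (occ-∷-bound (map proj₁ E) x (proj₁ bounded) openˣ , occ-∷-bound (map proj₂ E) y (proj₂ bounded) openʸ)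
               (large-survivors E Fs x y larges)
               (*-cancelˡ-< (suc r) _ _ (begin-strict
                 suc r * (length (survivors E Fs x y) * r ^ℕ t) ≡⟨ *-assoc (suc r) (length (survivors E Fs x y)) (r ^ℕ t) ⟨
                 suc r * length (survivors E Fs x y) * r ^ℕ t ≤⟨ *-monoˡ-≤ (r ^ℕ t) fewer ⟩
                 length Fs * r * r ^ℕ t ≡⟨ *-assoc (length Fs) r (r ^ℕ t) ⟩
                 length Fs * (r * r ^ℕ t) <⟨ few ⟩
                 suc r * suc r ^ℕ t ∎))
        where
        fewer : suc r * length (survivors E Fs x y) ≤ length Fs * r
        fewer = +-cancelʳ-≤ (length Fs) _ _ (begin
          suc r * S + length Fs ≤⟨ +-monoʳ-≤ (suc r * S) le ⟩
          suc r * S + 2 * c * h ≡⟨ cong (λ z → suc r * S + z * h) 2c≡1+r ⟩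
          suc r * S + suc r * h ≡⟨ *-distribˡ-+ (suc r) S h ⟨
          suc r * (S + h) ≡⟨ cong (suc r *_) (length-survivors E Fs x y) ⟩
          suc r * length Fs ≡⟨ eq r (length Fs) ⟩
          length Fs * r + length Fs ∎)
          where
          S = length (survivors E Fs x y)
          h = hitCount E Fs x y
          eq : ∀ r l → suc r * l ≡ l * r + l
          eq = solve-∀
      ... | E′ , bounded′ , E⊆E′ , hits =
        E′ , bounded′
           , (λ u v Euv → E⊆E′ u v (Equivalence.from (T-∨ {does (x ≟ᶠ u) ∧ does (y ≟ᶠ v)}) (inj₂ Euv)))
           , hits-survivors E Fs x y (graph E′)
               (E⊆E′ x y (Equivalence.from T-∨ (inj₁ (Equivalence.from T-∧ (T-≟-refl x , T-≟-refl y))))) hits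

  -- Unions of blocks

  ^-distribʳ-* : ∀ k m n → (m * n) ^ℕ k ≡ m ^ℕ k * n ^ℕ k
  ^-distribʳ-* zero    m n = refl
  ^-distribʳ-* (suc k) m n = trans (cong (m * n *_) (^-distribʳ-* k m n)) (eq m n (m ^ℕ k) (n ^ℕ k))
    where
    eq : ∀ m n a b → m * n * (a * b) ≡ m * a * (n * b)
    eq = solve-∀

  length-cartesianProductWith : ∀ {A B C : Set} (f : A → B → C) xs ys →
    length (cartesianProductWith f xs ys) ≡ length xs * length ys
  length-cartesianProductWith f []       ys = refl
  length-cartesianProductWith f (x ∷ xs) ys = trans (length-++ (map (f x) ys))
    (cong₂ _+_ (length-map (f x) ys) (length-cartesianProductWith f xs ys))

  vecs : ∀ {A : Set} → List A → ∀ n → List (Vec A n)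
  vecs as zero    = [] ∷ []
  vecs as (suc n) = cartesianProductWith _∷_ as (vecs as n)

  length-vecs : ∀ {A : Set} (as : List A) n → length (vecs as n) ≡ length as ^ℕ n
  length-vecs as zero    = refl
  length-vecs as (suc n) = trans (length-cartesianProductWith _∷_ as (vecs as n))
                                 (cong (length as *_) (length-vecs as n))

  ∈-vecs : ∀ {A : Set} {as : List A} → (∀ a → a ∈ˡ as) → ∀ {n} (v : Vec A n) → v ∈ˡ vecs as n
  ∈-vecs all []      = here refl
  ∈-vecs all (a ∷ v) = ∈-cartesianProductWith⁺ _∷_ (all a) (∈-vecs all v)

  bools : List Bool
  bools = true ∷ false ∷ []

  ∈-bools : ∀ b → b ∈ˡ bools
  ∈-bools true  = here refl
  ∈-bools false = there (here refl)

  blocks : ∀ {m n} → (Fin n → Fin m) → (Fin n → Fin m) → (Fin m → Fin m → Bool) → BipartiteGraph n n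
  blocks a b P x y = P (a x) (b y)

  blocksᵛ : ∀ {m n} → Vec (Fin m) n × Vec (Fin m) n → Vec (Vec Bool m) m → BipartiteGraph n n
  blocksᵛ (a , b) P = blocks (lookup a) (lookup b) (λ i → lookup (lookup P i))

  blockUnions : ∀ m n → List (BipartiteGraph n n)
  blockUnions m n = cartesianProductWith blocksᵛ
    (cartesianProduct (vecs (allFin m) n) (vecs (allFin m) n)) (vecs (vecs bools m) m)

  length-blockUnions : ∀ m n → length (blockUnions m n) ≡ m ^ℕ n * m ^ℕ n * (2 ^ℕ m) ^ℕ m
  length-blockUnions m n = begin
    length (blockUnions m n) ≡⟨ length-cartesianProductWith blocksᵛ (cartesianProduct V V) _ ⟩
    length (cartesianProduct V V) * length (vecs (vecs bools m) m)
      ≡⟨ cong₂ _*_ (length-cartesianProductWith _,_ V V) (length-vecs (vecs bools m) m) ⟩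
    length V * length V * length (vecs bools m) ^ℕ m
      ≡⟨ cong₂ (λ l l′ → l * l * l′ ^ℕ m)
           (trans (length-vecs (allFin m) n) (cong (_^ℕ n) (length-tabulate {n = m} (λ i → i))))
           (length-vecs bools m) ⟩
    m ^ℕ n * m ^ℕ n * (2 ^ℕ m) ^ℕ m ∎
    where
    open ≡-Reasoning
    V = vecs (allFin m) n

  ∈-blockUnions : ∀ {m n} (a b : Fin n → Fin m) P →
                  ∃[ F ] F ∈ˡ blockUnions m n × (∀ x y → F x y ≡ blocks a b P x y)
  ∈-blockUnions a b P =
    blocksᵛ (aᵛ , bᵛ) Pᵛ ,
    ∈-cartesianProductWith⁺ blocksᵛ
      (∈-cartesianProduct⁺ (∈-vecs ∈-allFin aᵛ) (∈-vecs ∈-allFin bᵛ))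
      (∈-vecs (∈-vecs ∈-bools) Pᵛ) ,
    λ x y → trans (cong₂ (λ i j → lookup (lookup Pᵛ i) j) (lookup∘tabulate a x) (lookup∘tabulate b y))
           (trans (cong (λ row → lookup row (b y)) (lookup∘tabulate (λ i → Vec.tabulate (P i)) (a x)))
                  (lookup∘tabulate (P (a x)) (b y)))
    where
    aᵛ = Vec.tabulate a
    bᵛ = Vec.tabulate b
    Pᵛ = Vec.tabulate (λ i → Vec.tabulate (P i))

  ∑∑-cong : ∀ {m n} {f g : Fin m → Fin n → ℕ} → (∀ i j → f i j ≡ g i j) → ∑∑ f ≡ ∑∑ g
  ∑∑-cong f≗g = sum-cong-≗ (λ i → sum-cong-≗ (f≗g i))

  area-cong : ∀ {n} {F G : BipartiteGraph n n} → (∀ x y → F x y ≡ G x y) → area F ≡ area G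
  area-cong F≗G = ∑∑-cong (λ x y → cong 𝟙 (F≗G x y))

  blockUnions-few : ∀ m n s r → 0 < n → m * m ≤ 4 * n → 16 * (m * m) * r ^ℕ s < suc r ^ℕ s →
    length (blockUnions m n) * r ^ℕ (s * n) < suc r ^ℕ (s * n)
  blockUnions-few m n s r 0<n mm≤4n few = begin-strict
    length (blockUnions m n) * r ^ℕ (s * n) ≡⟨ cong₂ _*_ (length-blockUnions m n) (sym (^-*-assoc r s n)) ⟩
    m ^ℕ n * m ^ℕ n * (2 ^ℕ m) ^ℕ m * (r ^ℕ s) ^ℕ n ≡⟨ cong₂ (λ u v → u * v * (r ^ℕ s) ^ℕ n) (sym (^-distribʳ-* n m m)) (^-*-assoc 2 m m) ⟩
    (m * m) ^ℕ n * 2 ^ℕ (m * m) * (r ^ℕ s) ^ℕ n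
      ≤⟨ *-monoˡ-≤ ((r ^ℕ s) ^ℕ n) (*-monoʳ-≤ ((m * m) ^ℕ n) (^-monoʳ-≤ 2 mm≤4n)) ⟩
    (m * m) ^ℕ n * 2 ^ℕ (4 * n) * (r ^ℕ s) ^ℕ n ≡⟨ cong (λ u → (m * m) ^ℕ n * u * (r ^ℕ s) ^ℕ n) (^-*-assoc 2 4 n) ⟨
    (m * m) ^ℕ n * 16 ^ℕ n * (r ^ℕ s) ^ℕ n ≡⟨ cong (_* (r ^ℕ s) ^ℕ n) (trans (*-comm _ (16 ^ℕ n)) (sym (^-distribʳ-* n 16 (m * m)))) ⟩
    (16 * (m * m)) ^ℕ n * (r ^ℕ s) ^ℕ n ≡⟨ ^-distribʳ-* n (16 * (m * m)) (r ^ℕ s) ⟨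
    (16 * (m * m) * r ^ℕ s) ^ℕ n <⟨ ^-monoˡ-< n {{>-nonZero 0<n}} few ⟩
    (suc r ^ℕ s) ^ℕ n ≡⟨ ^-*-assoc (suc r) s n ⟩
    suc r ^ℕ (s * n) ∎
    where open ≤-Reasoning

  HitsBlocks : ∀ {n} → BipartiteGraph n n → ℕ → ℕ → Set
  HitsBlocks {n} H c m = ∀ (a b : Fin n → Fin m) P → n * n ≤ c * area (blocks a b P) → Hits H (blocks a b P)

  length-filter-tabulate : ∀ {A : Set} {P : A → Set} (P? : Decidable P) {n} (f : Fin n → A) →
    length (filter P? (tabulate f)) ≡ ∑[ i < n ] 𝟙 (does (P? (f i)))
  length-filter-tabulate P? {zero}  f = refl
  length-filter-tabulate P? {suc n} f with does (P? (f zero))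
  ... | true  = cong suc (length-filter-tabulate P? (f ∘ suc))
  ... | false = length-filter-tabulate P? (f ∘ suc)

  maxDegree-≤ : ∀ {n Δ} (H : BipartiteGraph n n) → (∀ x → ∑[ y < n ] 𝟙 (H x y) ≤ Δ) →
                (∀ y → ∑[ x < n ] 𝟙 (H x y) ≤ Δ) → maxDegree H ≤ Δ
  maxDegree-≤ H rows columns = max≤v⁺ z≤n (++⁺
    (map⁺ (tabulate⁺ (λ x → ≤-trans (≤-reflexive (length-filter-tabulate (λ y → T? (H x y)) (λ y → y))) (rows x))))
    (map⁺ (tabulate⁺ (λ y → ≤-trans (≤-reflexive (length-filter-tabulate (λ x → T? (H x y)) (λ x → x))) (columns y)))))

  ∃-hitting-graph : ∀ {n} c r Δ s m → 0 < n → 0 < Δ → 2 * c ≡ suc r → s * (4 * c) ≤ Δ →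
    m * m ≤ 4 * n → 16 * (m * m) * r ^ℕ s < suc r ^ℕ s →
    Σ[ H ∈ BipartiteGraph n n ] maxDegree H ≤ Δ × HitsBlocks H c m
  ∃-hitting-graph {n} c r Δ s m 0<n 0<Δ 2c≡1+r sc≤Δ mm≤4n few =
    conclude (greedy s sc≤Δ r 2c≡1+r (s * n) [] larges ≤-refl ((λ _ → z≤n) , (λ _ → z≤n))
      (all-filter large? (blockUnions m n))
      (≤-<-trans (*-monoˡ-≤ (r ^ℕ (s * n)) (length-filter large? (blockUnions m n)))
                 (blockUnions-few m n s r 0<n mm≤4n few)))
    where
    open Greedy 0<n c Δ {{>-nonZero 0<Δ}}
    large? : Decidable Large
    large? F = n * n ≤? c * area F
    larges = filter large? (blockUnions m n)
    conclude : (Σ[ E ∈ Edges n ] Bounded E × (∀ x y → T (graph [] x y) → T (graph E x y)) × All (Hits (graph E)) larges) →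
               Σ[ H ∈ BipartiteGraph n n ] maxDegree H ≤ Δ × HitsBlocks H c m
    conclude (E , (rows , columns) , _ , hits) = graph E ,
      maxDegree-≤ (graph E) (λ x → ≤-trans (∑-graph-row E x) (rows x)) (λ y → ≤-trans (∑-graph-column E y) (columns y)) ,
      hitsBlocks
      where
      hitsBlocks : HitsBlocks (graph E) c m
      hitsBlocks a b P large with ∈-blockUnions a b P
      ... | F , F∈ , F≗
        with All.lookup hits (∈-filter⁺ large? F∈ (subst (λ A → n * n ≤ c * A) (sym (area-cong F≗)) large))
      ...   | x , y , Hxy , Fxy = x , y , Hxy , subst T (F≗ x y) Fxy

  -- From hit blocks to the two properties

  ≤-sum : ∀ {n} (f : Fin n → ℕ) i → f i ≤ sum f
  ≤-sum f zero    = m≤m+n _ _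
  ≤-sum f (suc i) = ≤-trans (≤-sum (f ∘ suc) i) (m≤n+m _ _)

  ≤-∑∑ : ∀ {m n} (f : Fin m → Fin n → ℕ) i j → f i j ≤ ∑∑ f
  ≤-∑∑ f i j = ≤-trans (≤-sum (f i) j) (≤-sum (sum ∘ f) i)

  ∑∑-comm : ∀ {k l m n} (f : Fin k → Fin l → Fin m → Fin n → ℕ) →
    ∑∑ (λ x y → ∑∑ (f x y)) ≡ ∑∑ (λ i j → ∑∑ (λ x y → f x y i j))
  ∑∑-comm f = begin
    ∑∑ (λ x y → ∑∑ (f x y)) ≡⟨ sum-cong-≗ (λ x → ∑-comm (λ y i → sum (f x y i))) ⟩
    ∑∑ (λ x i → ∑∑ (λ y j → f x y i j)) ≡⟨ ∑-comm (λ x i → ∑∑ (λ y j → f x y i j)) ⟩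
    ∑∑ (λ i x → ∑∑ (λ y j → f x y i j)) ≡⟨ ∑∑-cong (λ i x → ∑-comm (λ y j → f x y i j)) ⟩
    ∑∑ (λ i x → ∑∑ (λ j y → f x y i j)) ≡⟨ sum-cong-≗ (λ i → ∑-comm (λ x j → sum (λ y → f x y i j))) ⟩
    ∑∑ (λ i j → ∑∑ (λ x y → f x y i j)) ∎
    where open ≡-Reasoning

  ∑∑-product : ∀ {m n} (f : Fin m → ℕ) (g : Fin n → ℕ) → ∑∑ (λ i j → f i * g j) ≡ sum f * sum g
  ∑∑-product f g = trans (sum-cong-≗ (λ i → sym (*-distribˡ-sum (f i) g))) (sym (*-distribʳ-sum (sum g) f))

  ∣p∣≡∑ : ∀ {n} (p : Subset n) → ∣ p ∣ ≡ ∑[ x < n ] 𝟙 (lookup p x)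
  ∣p∣≡∑ []          = refl
  ∣p∣≡∑ (true  ∷ p) = cong suc (∣p∣≡∑ p)
  ∣p∣≡∑ (false ∷ p) = ∣p∣≡∑ p

  ∈⇒𝟙 : ∀ {n} {p : Subset n} {x} → x ∈ p → 𝟙 (lookup p x) ≡ 1
  ∈⇒𝟙 x∈p = cong 𝟙 ([]=⇒lookup x∈p)

  sumˡ-filter : ∀ {A : Set} {P : A → Set} (P? : Decidable P) (g : A → ℕ) xs →
    sumˡ (map g (filter P? xs)) ≡ sumˡ (map (λ a → 𝟙 (does (P? a)) * g a) xs)
  sumˡ-filter P? g []       = refl
  sumˡ-filter P? g (x ∷ xs) with does (P? x)
  ... | true  = cong₂ _+_ (sym (+-identityʳ (g x))) (sumˡ-filter P? g xs)
  ... | false = sumˡ-filter P? g xs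

  sumˡ-tabulate : ∀ {A : Set} (g : A → ℕ) {n} (f : Fin n → A) → sumˡ (map g (tabulate f)) ≡ sum (g ∘ f)
  sumˡ-tabulate g {zero}  f = refl
  sumˡ-tabulate g {suc n} f = cong₂ _+_ refl (sumˡ-tabulate g (f ∘ suc))

  sumˡ-cartesianProduct : ∀ {A B : Set} (g : A × B → ℕ) {m n} (f : Fin m → A) (h : Fin n → B) →
    sumˡ (map g (cartesianProduct (tabulate f) (tabulate h))) ≡ ∑∑ (λ i j → g (f i , h j))
  sumˡ-cartesianProduct g {zero}  f h = refl
  sumˡ-cartesianProduct g {suc m} f h = begin
    sumˡ (map g (map (f zero ,_) (tabulate h) ++ rest)) ≡⟨ cong sumˡ (map-++ g (map (f zero ,_) (tabulate h)) rest) ⟩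
    sumˡ (map g (map (f zero ,_) (tabulate h)) ++ map g rest) ≡⟨ sum-++ (map g (map (f zero ,_) (tabulate h))) (map g rest) ⟩
    sumˡ (map g (map (f zero ,_) (tabulate h))) + sumˡ (map g rest)
      ≡⟨ cong₂ _+_ (trans (cong (sumˡ ∘ map g) (map-tabulate h (f zero ,_))) (sumˡ-tabulate g (λ j → f zero , h j)))
                   (sumˡ-cartesianProduct g (f ∘ suc) h) ⟩
    ∑∑ (λ i j → g (f i , h j)) ∎
    where
    open ≡-Reasoning
    rest = cartesianProduct (tabulate (f ∘ suc)) (tabulate h)

  e-positive : ∀ {m n} (H : BipartiteGraph m n) {X′ Y′ x y} → x ∈ X′ → y ∈ Y′ → T (H x y) → 0 < e H X′ Y′
  e-positive H {X′} {Y′} x∈X′ y∈Y′ Hxy = ∈-length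
    (∈-filter⁺ (λ (x , y) → x ∈? X′ ×-dec y ∈? Y′ ×-dec T? (H x y))
               (∈-cartesianProduct⁺ (∈-allFin _) (∈-allFin _)) (x∈X′ , y∈Y′ , Hxy))

  T-not-does : ∀ {A : Set} (a? : Dec A) → T (not (does a?)) → ¬ A
  T-not-does (no ¬a) _ = ¬a

  -- Label zero stands for the exceptional set, label suc i for the i-th part.
  extend : ∀ {k} → (Fin k → Fin k → Bool) → Fin (suc k) → Fin (suc k) → Bool
  extend R zero    _       = false
  extend R (suc i) zero    = false
  extend R (suc i) (suc j) = R i j

  label : ∀ {k n} (𝒳 : Partition k n) → Fin n → Fin (suc k)
  label 𝒳 x with covers 𝒳 x
  ... | inj₁ (i , _) = suc i
  ... | inj₂ _       = zero

  label-suc : ∀ {k n} (𝒳 : Partition k n) x {i} → label 𝒳 x ≡ suc i → x ∈ part 𝒳 i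
  label-suc 𝒳 x eq with covers 𝒳 x
  label-suc 𝒳 x refl | inj₁ (i , x∈) = x∈

  label-zero : ∀ {k n} (𝒳 : Partition k n) x → label 𝒳 x ≡ zero → x ∈ D 𝒳
  label-zero 𝒳 x eq with covers 𝒳 x
  ... | inj₂ x∈ = x∈

  module _ {k n : ℕ} (H : BipartiteGraph n n) (𝒳 𝒴 : Partition k n) where

    open ≤-Reasoning

    ℓˣ = label 𝒳
    ℓʸ = label 𝒴

    same adjacent nonadjacent : Fin k → Fin k → Bool
    same i j        = does (i ≟ᶠ j)
    adjacent i j    = does (¬? (i ≟ᶠ j) ×-dec 0 <? e H (part 𝒳 i) (part 𝒴 j))
    nonadjacent i j = does (¬? (0 <? e H (part 𝒳 i) (part 𝒴 j)))

    crossSum≡∑∑ : crossSum H 𝒳 𝒴 ≡ ∑∑ (λ i j → 𝟙 (adjacent i j) * (∣ part 𝒳 i ∣ * ∣ part 𝒴 j ∣))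
    crossSum≡∑∑ = trans
      (sumˡ-filter (λ (i , j) → ¬? (i ≟ᶠ j) ×-dec 0 <? e H (part 𝒳 i) (part 𝒴 j))
                   (λ (i , j) → ∣ part 𝒳 i ∣ * ∣ part 𝒴 j ∣) (cartesianProduct (allFin k) (allFin k)))
      (sumˡ-cartesianProduct (λ (i , j) → 𝟙 (adjacent i j) * (∣ part 𝒳 i ∣ * ∣ part 𝒴 j ∣)) (λ i → i) (λ j → j))

    area-adjacent : area (blocks ℓˣ ℓʸ (extend adjacent)) ≤ crossSum H 𝒳 𝒴
    area-adjacent = begin
      ∑∑ (λ x y → 𝟙 (extend adjacent (ℓˣ x) (ℓʸ y))) ≤⟨ ∑∑-mono-≤ (λ x y → pointwise x y (ℓˣ x) (ℓʸ y) refl refl) ⟩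
      ∑∑ (λ x y → ∑∑ (term x y)) ≡⟨ ∑∑-comm term ⟩
      ∑∑ (λ i j → ∑∑ (λ x y → term x y i j)) ≡⟨ ∑∑-cong (λ i j → trans (sym (∑∑-*ˡ (𝟙 (adjacent i j)) (λ x y → 𝟙 (lookup (part 𝒳 i) x) * 𝟙 (lookup (part 𝒴 j) y))))
         (cong (𝟙 (adjacent i j) *_) (trans (∑∑-product (λ x → 𝟙 (lookup (part 𝒳 i) x)) (λ y → 𝟙 (lookup (part 𝒴 j) y)))
           (sym (cong₂ _*_ (∣p∣≡∑ (part 𝒳 i)) (∣p∣≡∑ (part 𝒴 j))))))) ⟩
      ∑∑ (λ i j → 𝟙 (adjacent i j) * (∣ part 𝒳 i ∣ * ∣ part 𝒴 j ∣)) ≡⟨ crossSum≡∑∑ ⟨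
      crossSum H 𝒳 𝒴 ∎
      where
      term : Fin n → Fin n → Fin k → Fin k → ℕ
      term x y i j = 𝟙 (adjacent i j) * (𝟙 (lookup (part 𝒳 i) x) * 𝟙 (lookup (part 𝒴 j) y))
      pointwise : ∀ x y s t → ℓˣ x ≡ s → ℓʸ y ≡ t → 𝟙 (extend adjacent s t) ≤ ∑∑ (term x y)
      pointwise x y zero    t       _ _ = z≤n
      pointwise x y (suc i) zero    _ _ = z≤n
      pointwise x y (suc i) (suc j) eqˣ eqʸ = begin
        𝟙 (adjacent i j) ≡⟨ *-identityʳ _ ⟨
        𝟙 (adjacent i j) * 1 ≡⟨ cong (𝟙 (adjacent i j) *_) (cong₂ _*_ (∈⇒𝟙 (label-suc 𝒳 x eqˣ)) (∈⇒𝟙 (label-suc 𝒴 y eqʸ))) ⟨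
        term x y i j ≤⟨ ≤-∑∑ (term x y) i j ⟩
        ∑∑ (term x y) ∎

    area-same : ∀ M → (∀ i → M * ∣ part 𝒴 i ∣ ≤ n) → M * area (blocks ℓˣ ℓʸ (extend same)) ≤ n * n
    area-same M small = begin
      M * area (blocks ℓˣ ℓʸ (extend same)) ≡⟨ *-distribˡ-sum M (λ x → ∑[ y < n ] 𝟙 (extend same (ℓˣ x) (ℓʸ y))) ⟩
      ∑[ x < n ] (M * ∑[ y < n ] 𝟙 (extend same (ℓˣ x) (ℓʸ y))) ≤⟨ sum-mono-≤ (λ x → row (ℓˣ x)) ⟩
      ∑[ x < n ] n ≡⟨ sum-const n n ⟩
      n * n ∎
      where
      pointwise : ∀ i y t → ℓʸ y ≡ t → 𝟙 (extend same (suc i) t) ≤ 𝟙 (lookup (part 𝒴 i) y)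
      pointwise i y zero    _  = z≤n
      pointwise i y (suc j) eq with i ≟ᶠ j
      ... | no  _    = z≤n
      ... | yes refl = ≤-reflexive (sym (∈⇒𝟙 (label-suc 𝒴 y eq)))
      row : ∀ s → M * ∑[ y < n ] 𝟙 (extend same s (ℓʸ y)) ≤ n
      row zero    = ≤-trans (≤-reflexive (trans (cong (M *_) (trans (sum-const n 0) (*-zeroʳ n))) (*-zeroʳ M))) z≤n
      row (suc i) = begin
        M * ∑[ y < n ] 𝟙 (extend same (suc i) (ℓʸ y)) ≤⟨ *-monoʳ-≤ M (sum-mono-≤ (λ y → pointwise i y (ℓʸ y) refl)) ⟩
        M * ∑[ y < n ] 𝟙 (lookup (part 𝒴 i) y) ≡⟨ cong (M *_) (∣p∣≡∑ (part 𝒴 i)) ⟨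
        M * ∣ part 𝒴 i ∣ ≤⟨ small i ⟩
        n ∎

    area-split : n * n ≤ n * ∣ D 𝒳 ∣ + n * ∣ D 𝒴 ∣ + area (blocks ℓˣ ℓʸ (extend same))
                         + area (blocks ℓˣ ℓʸ (extend nonadjacent)) + area (blocks ℓˣ ℓʸ (extend adjacent))
    area-split = begin
      n * n ≡⟨ trans (∑∑-row {n} {n} (λ _ → 1)) (cong (n *_) (trans (sum-const n 1) (*-identityʳ n))) ⟨
      ∑∑ {n} {n} (λ x y → 1) ≤⟨ ∑∑-mono-≤ (λ x y → pointwise x y (ℓˣ x) (ℓʸ y) refl refl) ⟩
      ∑∑ (λ x y → dx x + dy y + s x y + f x y + g x y) ≡⟨ ∑∑-distrib-+ (λ x y → dx x + dy y + s x y + f x y) g ⟩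
      ∑∑ (λ x y → dx x + dy y + s x y + f x y) + ∑∑ g ≡⟨ cong (_+ ∑∑ g) (∑∑-distrib-+ (λ x y → dx x + dy y + s x y) f) ⟩
      ∑∑ (λ x y → dx x + dy y + s x y) + ∑∑ f + ∑∑ g ≡⟨ cong (λ z → z + ∑∑ f + ∑∑ g) (∑∑-distrib-+ (λ x y → dx x + dy y) s) ⟩
      ∑∑ (λ x y → dx x + dy y) + ∑∑ s + ∑∑ f + ∑∑ g ≡⟨ cong (λ z → z + ∑∑ s + ∑∑ f + ∑∑ g) (∑∑-distrib-+ (λ x y → dx x) (λ x y → dy y)) ⟩
      ∑∑ {n} {n} (λ x y → dx x) + ∑∑ {n} {n} (λ x y → dy y) + ∑∑ s + ∑∑ f + ∑∑ g
        ≡⟨ cong (λ z → z + ∑∑ s + ∑∑ f + ∑∑ g) (cong₂ _+_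
             (trans (∑∑-row {n} {n} dx) (cong (n *_) (sym (∣p∣≡∑ (D 𝒳)))))
             (trans (∑∑-column {n} {n} dy) (cong (n *_) (sym (∣p∣≡∑ (D 𝒴)))))) ⟩
      n * ∣ D 𝒳 ∣ + n * ∣ D 𝒴 ∣ + ∑∑ s + ∑∑ f + ∑∑ g ∎
      where
      dx dy : Fin n → ℕ
      dx x = 𝟙 (lookup (D 𝒳) x)
      dy y = 𝟙 (lookup (D 𝒴) y)
      s f g : Fin n → Fin n → ℕ
      s x y = 𝟙 (extend same (ℓˣ x) (ℓʸ y))
      f x y = 𝟙 (extend nonadjacent (ℓˣ x) (ℓʸ y))
      g x y = 𝟙 (extend adjacent (ℓˣ x) (ℓʸ y))
      cover : ∀ i j → 1 ≤ 𝟙 (same i j) + 𝟙 (nonadjacent i j) + 𝟙 (adjacent i j)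
      cover i j with does (i ≟ᶠ j) | does (0 <? e H (part 𝒳 i) (part 𝒴 j))
      ... | true  | _     = s≤s z≤n
      ... | false | true  = s≤s z≤n
      ... | false | false = s≤s z≤n
      pointwise : ∀ x y s t → ℓˣ x ≡ s → ℓʸ y ≡ t →
        1 ≤ dx x + dy y + 𝟙 (extend same s t) + 𝟙 (extend nonadjacent s t) + 𝟙 (extend adjacent s t)
      pointwise x y zero t eqˣ _ rewrite ∈⇒𝟙 (label-zero 𝒳 x eqˣ) = s≤s z≤n
      pointwise x y (suc i) zero _ eqʸ rewrite ∈⇒𝟙 (label-zero 𝒴 y eqʸ) | +-comm (dx x) 1 = s≤s z≤n
      pointwise x y (suc i) (suc j) _ _ = ≤-trans (cover i j) (≤-trans (m≤n+m _ (dx x + dy y))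
        (≤-reflexive (eq (dx x + dy y) (𝟙 (same i j)) (𝟙 (nonadjacent i j)) (𝟙 (adjacent i j)))))
        where
        eq : ∀ d s f g → d + (s + f + g) ≡ d + s + f + g
        eq = solve-∀

    no-hit-nonadjacent : ¬ Hits H (blocks ℓˣ ℓʸ (extend nonadjacent))
    no-hit-nonadjacent (x , y , Hxy , nonadj) = impossible (ℓˣ x) (ℓʸ y) refl refl nonadj
      where
      impossible : ∀ s t → ℓˣ x ≡ s → ℓʸ y ≡ t → ¬ T (extend nonadjacent s t)
      impossible (suc i) (suc j) eqˣ eqʸ nonadj =
        T-not-does (0 <? e H (part 𝒳 i) (part 𝒴 j)) nonadj
          (e-positive H (label-suc 𝒳 x eqˣ) (label-suc 𝒴 y eqʸ) Hxy)

    crossSum-large : ∀ {c} → 100 ≤ c → HitsBlocks H c (suc k) → (∀ i → 20 * ∣ part 𝒴 i ∣ ≤ n) →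
      50 * ∣ D 𝒳 ∣ ≤ n → 50 * ∣ D 𝒴 ∣ ≤ n → 9 * (n * n) ≤ 10 * crossSum H 𝒳 𝒴
    crossSum-large {c} 100≤c hits small smallDˣ smallDʸ =
      *-cancelˡ-≤ 10 (+-cancelˡ-≤ (10 * N) _ _ (begin
        10 * N + 10 * (9 * N) ≡⟨ eq₁ N ⟩
        100 * N ≤⟨ *-monoʳ-≤ 100 area-split ⟩
        100 * (n * a + n * b + S + F + G) ≡⟨ eq₂ n a b S F G ⟩
        2 * (n * (50 * a)) + 2 * (n * (50 * b)) + 5 * (20 * S) + 100 * F + 100 * G
          ≤⟨ +-mono-≤ (+-mono-≤ (+-mono-≤ (+-mono-≤ (*-monoʳ-≤ 2 (*-monoʳ-≤ n smallDˣ)) (*-monoʳ-≤ 2 (*-monoʳ-≤ n smallDʸ)))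
               (*-monoʳ-≤ 5 (area-same 20 small))) 100F≤N) (*-monoʳ-≤ 100 area-adjacent) ⟩
        2 * N + 2 * N + 5 * N + N + 100 * C ≡⟨ eq₃ N C ⟩
        10 * N + 10 * (10 * C) ∎))
      where
      N = n * n
      a = ∣ D 𝒳 ∣
      b = ∣ D 𝒴 ∣
      S = area (blocks ℓˣ ℓʸ (extend same))
      F = area (blocks ℓˣ ℓʸ (extend nonadjacent))
      G = area (blocks ℓˣ ℓʸ (extend adjacent))
      C = crossSum H 𝒳 𝒴
      100F≤N : 100 * F ≤ N
      100F≤N = ≤-trans (*-monoˡ-≤ F 100≤c) (<⇒≤ (≰⇒> (λ large → no-hit-nonadjacent (hits ℓˣ ℓʸ (extend nonadjacent) large))))
      eq₁ : ∀ N → 10 * N + 10 * (9 * N) ≡ 100 * N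
      eq₁ = solve-∀
      eq₂ : ∀ n a b S F G → 100 * (n * a + n * b + S + F + G) ≡ 2 * (n * (50 * a)) + 2 * (n * (50 * b)) + 5 * (20 * S) + 100 * F + 100 * G
      eq₂ = solve-∀
      eq₃ : ∀ N C → 2 * N + 2 * N + 5 * N + N + 100 * C ≡ 10 * N + 10 * (10 * C)
      eq₃ = solve-∀

  e-large : ∀ {k n c d} (H : BipartiteGraph n n) → 0 < k → d * d ≤ c → HitsBlocks H c (suc k) →
    ∀ X′ Y′ → n ≤ d * ∣ X′ ∣ → n ≤ d * ∣ Y′ ∣ → 0 < e H X′ Y′
  e-large {suc k} {n} {c} {d} H _ dd≤c hits X′ Y′ largeˣ largeʸ = conclude (hits (indicator X′) (indicator Y′) (extend (λ _ _ → true)) (begin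
    n * n ≤⟨ *-mono-≤ largeˣ largeʸ ⟩
    d * ∣ X′ ∣ * (d * ∣ Y′ ∣) ≡⟨ eq d ∣ X′ ∣ ∣ Y′ ∣ ⟩
    d * d * (∣ X′ ∣ * ∣ Y′ ∣) ≤⟨ *-monoˡ-≤ _ dd≤c ⟩
    c * (∣ X′ ∣ * ∣ Y′ ∣) ≡⟨ cong (c *_) (cong₂ _*_ (∣p∣≡∑ X′) (∣p∣≡∑ Y′)) ⟩
    c * (sum (λ x → 𝟙 (lookup X′ x)) * sum (λ y → 𝟙 (lookup Y′ y))) ≡⟨ cong (c *_) (∑∑-product (λ x → 𝟙 (lookup X′ x)) (λ y → 𝟙 (lookup Y′ y))) ⟨
    c * ∑∑ (λ x y → 𝟙 (lookup X′ x) * 𝟙 (lookup Y′ y)) ≡⟨ cong (c *_) (∑∑-cong pointwise) ⟨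
    c * area (blocks (indicator X′) (indicator Y′) (extend (λ _ _ → true))) ∎))
    where
    open ≤-Reasoning
    indicator : Subset n → Fin n → Fin (suc (suc k))
    indicator p x = if lookup p x then suc zero else zero
    eq : ∀ d a b → d * a * (d * b) ≡ d * d * (a * b)
    eq = solve-∀
    pointwise : ∀ x y → 𝟙 (extend (λ _ _ → true) (indicator X′ x) (indicator Y′ y)) ≡ 𝟙 (lookup X′ x) * 𝟙 (lookup Y′ y)
    pointwise x y with lookup X′ x | lookup Y′ y
    ... | true  | true  = refl
    ... | true  | false = refl
    ... | false | _     = refl
    conclude : Hits H (blocks (indicator X′) (indicator Y′) (extend (λ _ _ → true))) → 0 < e H X′ Y′
    conclude (x , y , Hxy , xy∈) with lookup X′ x in eqˣ | lookup Y′ y in eqʸ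
    ... | true | true = e-positive H (lookup⇒[]= x X′ eqˣ) (lookup⇒[]= y Y′ eqʸ) Hxy

  -- Exponential estimates

  [1+1/q]^N-bound : ∀ N d → suc (N + d) ^ℕ N * d ≤ (N + d) ^ℕ N * (N + d)
  [1+1/q]^N-bound N d = go N d refl
    where
    open ≤-Reasoning
    go : ∀ M d′ → M + d′ ≡ N + d → suc (N + d) ^ℕ M * d′ ≤ (N + d) ^ℕ M * (N + d)
    go zero    d′ eq = ≤-reflexive (cong (1 *_) eq)
    go (suc M) d′ eq = begin
      suc q * suc q ^ℕ M * d′ ≡⟨ eq₁ q (suc q ^ℕ M) d′ ⟩
      suc q ^ℕ M * (d′ + q * d′) ≤⟨ *-monoʳ-≤ (suc q ^ℕ M) (+-monoˡ-≤ (q * d′) (m+n≤o⇒n≤o (suc M) (≤-reflexive eq))) ⟩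
      suc q ^ℕ M * (q + q * d′) ≡⟨ eq₂ q (suc q ^ℕ M) d′ ⟩
      q * (suc q ^ℕ M * suc d′) ≤⟨ *-monoʳ-≤ q (go M (suc d′) (trans (+-suc M d′) eq)) ⟩
      q * (q ^ℕ M * q) ≡⟨ *-assoc q (q ^ℕ M) q ⟨
      q * q ^ℕ M * q ∎
      where
      q = N + d
      eq₁ : ∀ q p d → suc q * p * d ≡ p * (d + q * d)
      eq₁ = solve-∀
      eq₂ : ∀ q p d → p * (q + q * d) ≡ q * (p * suc d)
      eq₂ = solve-∀

  bernoulli : ∀ v s → v ^ℕ s * (suc v + s) ≤ suc v ^ℕ s * suc v
  bernoulli v zero    = ≤-reflexive (cong (1 *_) (+-identityʳ (suc v)))
  bernoulli v (suc s) = begin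
    v * v ^ℕ s * (suc v + suc s) ≤⟨ m≤m+n _ (v ^ℕ s * suc s) ⟩
    v * v ^ℕ s * (suc v + suc s) + v ^ℕ s * suc s ≡⟨ eq v s (v ^ℕ s) ⟩
    suc v * (v ^ℕ s * (suc v + s)) ≤⟨ *-monoʳ-≤ (suc v) (bernoulli v s) ⟩
    suc v * (suc v ^ℕ s * suc v) ≡⟨ *-assoc (suc v) (suc v ^ℕ s) (suc v) ⟨
    suc v * suc v ^ℕ s * suc v ∎
    where
    open ≤-Reasoning
    eq : ∀ v s p → v * p * (suc v + suc s) + p * suc s ≡ suc v * (p * (suc v + s))
    eq = solve-∀

  power-small : ∀ v Δ → 19 * suc v ≤ Δ → 20 * v ^ℕ Δ ≤ suc v ^ℕ Δ
  power-small v Δ large = *-cancelʳ-≤ _ _ (suc v) (begin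
    20 * v ^ℕ Δ * suc v ≡⟨ eq (v ^ℕ Δ) (suc v) ⟩
    v ^ℕ Δ * (suc v + 19 * suc v) ≤⟨ *-monoʳ-≤ (v ^ℕ Δ) (+-monoʳ-≤ (suc v) large) ⟩
    v ^ℕ Δ * (suc v + Δ) ≤⟨ bernoulli v Δ ⟩
    suc v ^ℕ Δ * suc v ∎)
    where
    open ≤-Reasoning
    eq : ∀ p w → 20 * p * w ≡ p * (w + 19 * w)
    eq = solve-∀

  power-ratio-mono : ∀ k q {Δ Δ′} → Δ ≤ Δ′ → k * q ^ℕ Δ ≤ suc q ^ℕ Δ → k * q ^ℕ Δ′ ≤ suc q ^ℕ Δ′
  power-ratio-mono k q {Δ} {Δ′} Δ≤Δ′ kq≤ = begin
    k * q ^ℕ Δ′ ≡⟨ cong (λ t → k * q ^ℕ t) (m+[n∸m]≡n Δ≤Δ′) ⟨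
    k * q ^ℕ (Δ + (Δ′ ∸ Δ)) ≡⟨ cong (k *_) (^-distribˡ-+-* q Δ (Δ′ ∸ Δ)) ⟩
    k * (q ^ℕ Δ * q ^ℕ (Δ′ ∸ Δ)) ≡⟨ *-assoc k _ _ ⟨
    k * q ^ℕ Δ * q ^ℕ (Δ′ ∸ Δ) ≤⟨ *-mono-≤ kq≤ (^-monoˡ-≤ (Δ′ ∸ Δ) (n≤1+n q)) ⟩
    suc q ^ℕ Δ * suc q ^ℕ (Δ′ ∸ Δ) ≡⟨ ^-distribˡ-+-* (suc q) Δ (Δ′ ∸ Δ) ⟨
    suc q ^ℕ (Δ + (Δ′ ∸ Δ)) ≡⟨ cong (suc q ^ℕ_) (m+[n∸m]≡n Δ≤Δ′) ⟩
    suc q ^ℕ Δ′ ∎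
    where open ≤-Reasoning

  ^-double : ∀ q t → q ^ℕ (2 * t) ≡ q ^ℕ t * q ^ℕ t
  ^-double q t = trans (^-distribˡ-+-* q t (t + 0)) (cong (λ u → q ^ℕ t * q ^ℕ u) (+-identityʳ t))

  [k*q^t]² : ∀ k q t → (k * q ^ℕ t) * (k * q ^ℕ t) ≡ k * k * q ^ℕ (2 * t)
  [k*q^t]² k q t = trans (eq k (q ^ℕ t)) (cong (k * k *_) (sym (^-double q t)))
    where
    eq : ∀ k p → (k * p) * (k * p) ≡ k * k * (p * p)
    eq = solve-∀

  -- (1 + 1/q)^(2w) ≤ 1 + 1/w for q = 2w(w + 1).
  parts-bound : ∀ w .{{_ : NonZero w}} k s → let q = 2 * w * suc w in ∀ {Δ} → Δ ≤ suc s * w →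
    k * q ^ℕ Δ ≤ suc q ^ℕ Δ → k * k * w ^ℕ suc s ≤ suc w ^ℕ suc s
  parts-bound w k s {Δ} Δ≤ kq≤ = *-cancelʳ-≤ _ _ (q ^ℕ (N * suc s)) {{m^n≢0 q (N * suc s)}} (begin
    k * k * w ^ℕ suc s * q ^ℕ (N * suc s) ≡⟨ eq (k * k) (w ^ℕ suc s) _ ⟩
    k * k * q ^ℕ (N * suc s) * w ^ℕ suc s ≤⟨ *-monoˡ-≤ (w ^ℕ suc s) squared ⟩
    suc q ^ℕ (N * suc s) * w ^ℕ suc s ≡⟨ cong (_* w ^ℕ suc s) (^-*-assoc (suc q) N (suc s)) ⟨
    (suc q ^ℕ N) ^ℕ suc s * w ^ℕ suc s ≡⟨ ^-distribʳ-* (suc s) (suc q ^ℕ N) w ⟨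
    (suc q ^ℕ N * w) ^ℕ suc s ≤⟨ ^-monoˡ-≤ (suc s) base ⟩
    (q ^ℕ N * suc w) ^ℕ suc s ≡⟨ ^-distribʳ-* (suc s) (q ^ℕ N) (suc w) ⟩
    (q ^ℕ N) ^ℕ suc s * suc w ^ℕ suc s ≡⟨ cong (_* suc w ^ℕ suc s) (^-*-assoc q N (suc s)) ⟩
    q ^ℕ (N * suc s) * suc w ^ℕ suc s ≡⟨ *-comm (q ^ℕ (N * suc s)) _ ⟩
    suc w ^ℕ suc s * q ^ℕ (N * suc s) ∎)
    where
    open ≤-Reasoning
    N = 2 * w
    q = N * suc w
    instance
      N≢0 : NonZero N
      N≢0 = m*n≢0 2 w
      q≢0 : NonZero q
      q≢0 = m*n≢0 N (suc w)
    eq : ∀ a b d → a * b * d ≡ a * d * b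
    eq = solve-∀
    eqN : N * suc s ≡ 2 * (suc s * w)
    eqN = trans (*-assoc 2 w (suc s)) (cong (2 *_) (*-comm w (suc s)))
    squared : k * k * q ^ℕ (N * suc s) ≤ suc q ^ℕ (N * suc s)
    squared = begin
      k * k * q ^ℕ (N * suc s) ≡⟨ cong (λ t → k * k * q ^ℕ t) eqN ⟩
      k * k * q ^ℕ (2 * (suc s * w)) ≡⟨ [k*q^t]² k q (suc s * w) ⟨
      (k * q ^ℕ (suc s * w)) * (k * q ^ℕ (suc s * w)) ≤⟨ *-mono-≤ raised raised ⟩
      suc q ^ℕ (suc s * w) * suc q ^ℕ (suc s * w) ≡⟨ ^-double (suc q) (suc s * w) ⟨
      suc q ^ℕ (2 * (suc s * w)) ≡⟨ cong (suc q ^ℕ_) eqN ⟨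
      suc q ^ℕ (N * suc s) ∎
      where raised = power-ratio-mono k q Δ≤ kq≤
    base : suc q ^ℕ N * w ≤ q ^ℕ N * suc w
    base = *-cancelʳ-≤ _ _ N (begin
      suc q ^ℕ N * w * N ≡⟨ trans (*-assoc (suc q ^ℕ N) w N) (cong₂ (λ a b → suc a ^ℕ N * b) (*-suc N w) (*-comm w N)) ⟩
      suc (N + N * w) ^ℕ N * (N * w) ≤⟨ [1+1/q]^N-bound N (N * w) ⟩
      (N + N * w) ^ℕ N * (N + N * w) ≡⟨ cong (λ a → a ^ℕ N * a) (*-suc N w) ⟨
      q ^ℕ N * q ≡⟨ trans (cong (q ^ℕ N *_) (*-comm N (suc w))) (sym (*-assoc (q ^ℕ N) (suc w) N)) ⟩
      q ^ℕ N * suc w * N ∎)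

  few-partitions : ∀ r k s → let v = suc (2 * r) in 64 * suc (suc v) ≤ s →
    k * k * suc v ^ℕ suc s ≤ suc (suc v) ^ℕ suc s → 64 * (k * k) * r ^ℕ s < suc r ^ℕ s
  few-partitions r k s large kkw≤ = *-cancelʳ-< _ _ _ (begin-strict
    64 * (k * k) * r ^ℕ s * w ^ℕ suc s ≡⟨ eq₁ (k * k) (r ^ℕ s) (w ^ℕ suc s) ⟩
    64 * r ^ℕ s * (k * k * w ^ℕ suc s) ≤⟨ *-monoʳ-≤ (64 * r ^ℕ s) kkw≤ ⟩
    64 * r ^ℕ s * (suc w * suc w ^ℕ s) ≡⟨ eq₂ (r ^ℕ s) (suc w) (suc w ^ℕ s) ⟩
    64 * suc w * (suc w ^ℕ s * r ^ℕ s) ≡⟨ cong (64 * suc w *_) (^-distribʳ-* s (suc w) r) ⟨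
    64 * suc w * (suc w * r) ^ℕ s ≤⟨ *-monoʳ-≤ (64 * suc w) (^-monoˡ-≤ s (≤-trans (n≤1+n _) (≤-reflexive (eq₃ r)))) ⟩
    64 * suc w * (v * suc r) ^ℕ s ≡⟨ cong (64 * suc w *_) (^-distribʳ-* s v (suc r)) ⟩
    64 * suc w * (v ^ℕ s * suc r ^ℕ s) ≤⟨ *-monoˡ-≤ _ large ⟩
    s * (v ^ℕ s * suc r ^ℕ s) <⟨ *-monoˡ-< (v ^ℕ s * suc r ^ℕ s) {{m*n≢0 _ _ {{m^n≢0 v s}} {{m^n≢0 (suc r) s}}}} (m<n+m s {w} z<s) ⟩
    (w + s) * (v ^ℕ s * suc r ^ℕ s) ≡⟨ eq₄ (w + s) (v ^ℕ s) (suc r ^ℕ s) ⟩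
    suc r ^ℕ s * (v ^ℕ s * (w + s)) ≤⟨ *-monoʳ-≤ (suc r ^ℕ s) (bernoulli v s) ⟩
    suc r ^ℕ s * (w ^ℕ s * w) ≡⟨ cong (suc r ^ℕ s *_) (*-comm (w ^ℕ s) w) ⟩
    suc r ^ℕ s * w ^ℕ suc s ∎)
    where
    open ≤-Reasoning
    v = suc (2 * r)
    w = suc v
    eq₁ : ∀ a b d → 64 * a * b * d ≡ 64 * b * (a * d)
    eq₁ = solve-∀
    eq₂ : ∀ b d f → 64 * b * (d * f) ≡ 64 * d * (f * b)
    eq₂ = solve-∀
    eq₃ : ∀ r → suc (suc (suc (suc (2 * r))) * r) ≡ suc (2 * r) * suc r
    eq₃ = solve-∀
    eq₄ : ∀ a b d → a * (b * d) ≡ d * (b * a)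
    eq₄ = solve-∀

  -- Rationals as ratios of naturals

  fromℕ≡mkℚ : ∀ m → fromℕ m ≡ mkℚ (+ m) 0 (coprime-sym (1-coprimeTo m))
  fromℕ≡mkℚ m = ℚ.normalize-coprime (coprime-sym (1-coprimeTo m))

  fromℕ-homo-* : ∀ m n → fromℕ (m * n) ≡ fromℕ m ℚ.* fromℕ n
  fromℕ-homo-* m n = ℚ.toℚᵘ-injective (begin
    toℚᵘ (fromℕ (m * n)) ≈⟨ ℚ.toℚᵘ-fromℚᵘ (mkℚᵘ (+ (m * n)) 0) ⟩
    mkℚᵘ (+ (m * n)) 0 ≡⟨ cong (λ z → mkℚᵘ z 0) (ℤ.pos-* m n) ⟩
    mkℚᵘ (+ m) 0 ℚᵘ.* mkℚᵘ (+ n) 0 ≈⟨ ℚᵘ.*-cong (ℚ.toℚᵘ-fromℚᵘ (mkℚᵘ (+ m) 0)) (ℚ.toℚᵘ-fromℚᵘ (mkℚᵘ (+ n) 0)) ⟨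
    toℚᵘ (fromℕ m) ℚᵘ.* toℚᵘ (fromℕ n) ≈⟨ ℚ.toℚᵘ-homo-* (fromℕ m) (fromℕ n) ⟨
    toℚᵘ (fromℕ m ℚ.* fromℕ n) ∎)
    where open import Relation.Binary.Reasoning.Setoid ℚᵘ.≃-setoid

  fromℕ-mono-≤ : ∀ {m n} → m ≤ n → fromℕ m ℚ.≤ fromℕ n
  fromℕ-mono-≤ {m} {n} m≤n rewrite fromℕ≡mkℚ m | fromℕ≡mkℚ n =
    *≤* (ℤ.*-monoʳ-≤-nonNeg (+ 1) (+≤+ m≤n))

  fromℕ-cancel-≤ : ∀ {m n} → fromℕ m ℚ.≤ fromℕ n → m ≤ n
  fromℕ-cancel-≤ {m} {n} m≤n rewrite fromℕ≡mkℚ m | fromℕ≡mkℚ n with m≤n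
  ... | *≤* m≤n = ℤ.drop‿+≤+ (ℤ.*-cancelʳ-≤-pos (+ m) (+ n) (+ 1) m≤n)

  fromℕ-nonNeg : ∀ m → NonNegative (fromℕ m)
  fromℕ-nonNeg m = ℚ.normalize-nonNeg m 1

  fromℕ-pos : ∀ m .{{_ : NonZero m}} → Positive (fromℕ m)
  fromℕ-pos m = ℚ.normalize-pos m 1

  -- Says p = a / b, so that inequalities between rationals become inequalities in ℕ.
  Ratio : ℚ → ℕ → ℕ → Set
  Ratio p a b = p ℚ.* fromℕ b ≡ fromℕ a

  /-ratio : ∀ a b .{{_ : NonZero b}} → Ratio (+ a ℚ./ b) a b
  /-ratio a (suc b) = ℚ.toℚᵘ-injective (begin
    toℚᵘ (+ a ℚ./ suc b ℚ.* fromℕ (suc b)) ≈⟨ ℚ.toℚᵘ-homo-* (+ a ℚ./ suc b) (fromℕ (suc b)) ⟩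
    toℚᵘ (+ a ℚ./ suc b) ℚᵘ.* toℚᵘ (fromℕ (suc b)) ≈⟨ ℚᵘ.*-cong (ℚ.toℚᵘ-fromℚᵘ (mkℚᵘ (+ a) b)) (ℚ.toℚᵘ-fromℚᵘ (mkℚᵘ (+ suc b) 0)) ⟩
    mkℚᵘ (+ a) b ℚᵘ.* mkℚᵘ (+ suc b) 0 ≈⟨ *≡* (trans (ℤ.*-identityʳ _) (cong (λ d → + a ℤ.* (+ d)) (sym (*-identityʳ (suc b))))) ⟩
    mkℚᵘ (+ a) 0 ≈⟨ ℚ.toℚᵘ-fromℚᵘ (mkℚᵘ (+ a) 0) ⟨
    toℚᵘ (fromℕ a) ∎)
    where open import Relation.Binary.Reasoning.Setoid ℚᵘ.≃-setoid

  ratio-1 : Ratio 1ℚ 1 1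
  ratio-1 = refl

  ratio-* : ∀ {p q a b a′ b′} → Ratio p a b → Ratio q a′ b′ → Ratio (p ℚ.* q) (a * a′) (b * b′)
  ratio-* {p} {q} {a} {b} {a′} {b′} p≐ q≐ = begin
    p ℚ.* q ℚ.* fromℕ (b * b′) ≡⟨ cong (p ℚ.* q ℚ.*_) (fromℕ-homo-* b b′) ⟩
    p ℚ.* q ℚ.* (fromℕ b ℚ.* fromℕ b′) ≡⟨ solve 4 (λ p q b b′ → (p :* q) :* (b :* b′) := (p :* b) :* (q :* b′)) refl p q (fromℕ b) (fromℕ b′) ⟩
    p ℚ.* fromℕ b ℚ.* (q ℚ.* fromℕ b′) ≡⟨ cong₂ ℚ._*_ p≐ q≐ ⟩
    fromℕ a ℚ.* fromℕ a′ ≡⟨ fromℕ-homo-* a a′ ⟨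
    fromℕ (a * a′) ∎
    where
    open ≡-Reasoning
    open +-*-Solver

  ratio-^ : ∀ {p a b} n → Ratio p a b → Ratio (p ^ n) (a ^ℕ n) (b ^ℕ n)
  ratio-^ zero p≐ = ratio-1
  ratio-^ {p} {a} {b} (suc n) p≐ = ratio-* {p} {p ^ n} {a} {b} {a ^ℕ n} {b ^ℕ n} p≐ (ratio-^ {p} {a} {b} n p≐)

  ratio-fromℕ : ∀ m → Ratio (fromℕ m) m 1
  ratio-fromℕ m = ℚ.*-identityʳ (fromℕ m)

  ratio-scale : ∀ {p a b} m → Ratio p a b → Ratio p (a * m) (b * m)
  ratio-scale {p} {a} {b} m p≐ = begin
    p ℚ.* fromℕ (b * m) ≡⟨ cong (p ℚ.*_) (fromℕ-homo-* b m) ⟩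
    p ℚ.* (fromℕ b ℚ.* fromℕ m) ≡⟨ ℚ.*-assoc p (fromℕ b) (fromℕ m) ⟨
    p ℚ.* fromℕ b ℚ.* fromℕ m ≡⟨ cong (ℚ._* fromℕ m) p≐ ⟩
    fromℕ a ℚ.* fromℕ m ≡⟨ fromℕ-homo-* a m ⟨
    fromℕ (a * m) ∎
    where open ≡-Reasoning

  ratio-scaleˡ : ∀ {p a b} m → Ratio p a b → Ratio p (a * m) (m * b)
  ratio-scaleˡ {p} {a} {b} m p≐ = subst (Ratio p (a * m)) (*-comm b m) (ratio-scale {p} {a} {b} m p≐)

  ratio-cancel-≤ : ∀ {p q a b a′ b′} → Ratio p a b → Ratio q a′ b′ → p ℚ.≤ q → a * b′ ≤ a′ * b
  ratio-cancel-≤ {p} {q} {a} {b} {a′} {b′} p≐ q≐ p≤q = fromℕ-cancel-≤ (begin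
    fromℕ (a * b′) ≡⟨ ratio-scale {p} {a} {b} b′ p≐ ⟨
    p ℚ.* fromℕ (b * b′) ≤⟨ ℚ.*-monoʳ-≤-nonNeg (fromℕ (b * b′)) {{fromℕ-nonNeg (b * b′)}} p≤q ⟩
    q ℚ.* fromℕ (b * b′) ≡⟨ ratio-scaleˡ {q} {a′} {b′} b q≐ ⟩
    fromℕ (a′ * b) ∎)
    where open ℚ.≤-Reasoning

  ratio-mono-≤ : ∀ {p q a b a′ b′} .{{_ : NonZero b}} .{{_ : NonZero b′}} → Ratio p a b → Ratio q a′ b′ →
                 a * b′ ≤ a′ * b → p ℚ.≤ q
  ratio-mono-≤ {p} {q} {a} {b} {a′} {b′} p≐ q≐ le =
    ℚ.*-cancelʳ-≤-pos (fromℕ (b * b′)) {{fromℕ-pos (b * b′) {{m*n≢0 b b′}}}} (begin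
      p ℚ.* fromℕ (b * b′) ≡⟨ ratio-scale {p} {a} {b} b′ p≐ ⟩
      fromℕ (a * b′) ≤⟨ fromℕ-mono-≤ le ⟩
      fromℕ (a′ * b) ≡⟨ ratio-scaleˡ {q} {a′} {b′} b q≐ ⟨
      q ℚ.* fromℕ (b * b′) ∎)
    where open ℚ.≤-Reasoning

  ratio-mono-< : ∀ {p q a b a′ b′} → Ratio p a b → Ratio q a′ b′ → a * b′ < a′ * b → p ℚ.< q
  ratio-mono-< {p} {q} {a} {b} {a′} {b′} p≐ q≐ lt =
    ℚ.≰⇒> (λ q≤p → <⇒≱ lt (ratio-cancel-≤ {q} {p} {a′} {b′} {a} {b} q≐ p≐ q≤p))

  ratio-÷ : ∀ {p q a b d} .{{_ : ℚ.NonZero q}} → Ratio p a b → Ratio q d b → Ratio (p ℚ.÷ q) a d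
  ratio-÷ {p} {q} {a} {b} {d} p≐ q≐ = begin
    p ℚ.* ℚ.1/ q ℚ.* fromℕ d ≡⟨ cong (p ℚ.* ℚ.1/ q ℚ.*_) q≐ ⟨
    p ℚ.* ℚ.1/ q ℚ.* (q ℚ.* fromℕ b) ≡⟨ ℚ.*-assoc p (ℚ.1/ q) _ ⟩
    p ℚ.* (ℚ.1/ q ℚ.* (q ℚ.* fromℕ b)) ≡⟨ cong (p ℚ.*_) (ℚ.*-assoc (ℚ.1/ q) q (fromℕ b)) ⟨
    p ℚ.* (ℚ.1/ q ℚ.* q ℚ.* fromℕ b) ≡⟨ cong (λ z → p ℚ.* (z ℚ.* fromℕ b)) (ℚ.*-inverseˡ q) ⟩
    p ℚ.* (1ℚ ℚ.* fromℕ b) ≡⟨ cong (p ℚ.*_) (ℚ.*-identityˡ (fromℕ b)) ⟩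
    p ℚ.* fromℕ b ≡⟨ p≐ ⟩
    fromℕ a ∎
    where open ≡-Reasoning

  ⌊⌋ℕ-bounds : ∀ {p} → 1ℚ ℚ.≤ p → 0 < ⌊ p ⌋ℕ × fromℕ ⌊ p ⌋ℕ ℚ.≤ p
  ⌊⌋ℕ-bounds {mkℚ (-[1+ a ]) d c} (*≤* ())
  ⌊⌋ℕ-bounds {mkℚ (+ a) d c} (*≤* le) =
    subst (λ k → 0 < k × fromℕ k ℚ.≤ mkℚ (+ a) d c) (sym floor≡) (m≥n⇒m/n>0 1+d≤a , below)
    where
    floor≡ : ⌊ mkℚ (+ a) d c ⌋ℕ ≡ a / suc d
    floor≡ = cong ℤ.∣_∣ (ℤ.*-identityˡ (+ (a / suc d)))
    1+d≤a : suc d ≤ a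
    1+d≤a = subst₂ _≤_ (+-identityʳ (suc d)) (*-identityʳ a)
              (ℤ.drop‿+≤+ (subst (ℤ._≤ + (a * 1)) (sym (ℤ.pos-* 1 (suc d)))
                (subst (+ 1 ℤ.* + suc d ℤ.≤_) (sym (ℤ.pos-* a 1)) le)))
    below : fromℕ (a / suc d) ℚ.≤ mkℚ (+ a) d c
    below = subst (ℚ._≤ mkℚ (+ a) d c) (sym (fromℕ≡mkℚ (a / suc d)))
      (*≤* (subst₂ ℤ._≤_ (ℤ.pos-* (a / suc d) (suc d)) (ℤ.pos-* a 1)
        (+≤+ (≤-trans (m/n*n≤m a (suc d)) (≤-reflexive (sym (*-identityʳ a)))))))

  cross-bound : ∀ a b d M n C → 0 < n → a * (b * b) < M * 9 → 10 * M ≡ d * (d * d) →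
    9 * (n * n) ≤ 10 * C → a * (b * n) ^ℕ 2 * 1 < C * (d * (d * 1) ^ℕ 2)
  cross-bound a b d M n C 0<n a<M eq 9n²≤10C = begin-strict
    a * (b * n * (b * n * 1)) * 1 ≡⟨ eq₁ a b n ⟩
    a * (b * b) * (n * n) <⟨ *-monoˡ-< (n * n) {{>-nonZero (*-mono-≤ 0<n 0<n)}} a<M ⟩
    M * 9 * (n * n) ≡⟨ *-assoc M 9 (n * n) ⟩
    M * (9 * (n * n)) ≤⟨ *-monoʳ-≤ M 9n²≤10C ⟩
    M * (10 * C) ≡⟨ eq₂ M C ⟩
    C * (10 * M) ≡⟨ cong (C *_) eq ⟩
    C * (d * (d * d)) ≡⟨ eq₃ C d ⟩
    C * (d * (d * 1 * (d * 1 * 1))) ∎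
    where
    open ≤-Reasoning
    eq₁ : ∀ a b n → a * (b * n * (b * n * 1)) * 1 ≡ a * (b * b) * (n * n)
    eq₁ = solve-∀
    eq₂ : ∀ M C → M * (10 * C) ≡ C * (10 * M)
    eq₂ = solve-∀
    eq₃ : ∀ C d → C * (d * (d * d)) ≡ C * (d * (d * 1 * (d * 1 * 1)))
    eq₃ = solve-∀

  -- Choice of the constants

  module Construction (c r : ℕ) .{{_ : NonZero c}} (2c≡1+r : 2 * c ≡ suc r) (10000≤c : 10000 ≤ c) where

    instance
      w≢0 : NonZero (4 * c)
      w≢0 = m*n≢0 4 c
      q≢0 : NonZero (2 * (4 * c) * suc (4 * c))
      q≢0 = m*n≢0 (2 * (4 * c)) (suc (4 * c)) {{m*n≢0 2 (4 * c)}}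
      2q≢0 : NonZero (2 * (4 * c) * suc (4 * c) * 2)
      2q≢0 = m*n≢0 (2 * (4 * c) * suc (4 * c)) 2

    -- c₀ = 1 + 1/q has c₀^(2w) ≤ 1 + 1/w, and (1 + 1/w)(1 - 1/(2c)) < 1, so that 64 k² (1 - 1/(2c))^(Δ/w)
    -- decays in Δ; c₁ is chosen so that c₁/c₀ = v/(v + 1).
    w q v Δ₀ : ℕ
    w = 4 * c
    q = 2 * w * suc w
    v = suc (q * 2)
    Δ₀ = 64 * suc w * w + 19 * suc v

    c₀ c₁ : ℚ
    c₀ = + suc q ℚ./ q
    c₁ = + v ℚ./ (q * 2)

    w≡ : w ≡ suc (suc (2 * r))
    w≡ = trans (*-assoc 2 2 c) (trans (cong (2 *_) 2c≡1+r) (*-suc 2 r))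

    c₀≐ : Ratio c₀ (suc q) q
    c₀≐ = /-ratio (suc q) q

    c₀≐′ : Ratio c₀ (suc v) (q * 2)
    c₀≐′ = ratio-scale {c₀} {suc q} {q} 2 c₀≐

    c₁≐ : Ratio c₁ v (q * 2)
    c₁≐ = /-ratio v (q * 2)

    c₁<c₀ : c₁ ℚ.< c₀
    c₁<c₀ = ratio-mono-< {c₁} {c₀} {v} {q * 2} {suc v} {q * 2} c₁≐ c₀≐′ (*-monoˡ-< (q * 2) (n<1+n v))

    1<c₁ : 1ℚ ℚ.< c₁
    1<c₁ = ratio-mono-< {1ℚ} {c₁} {1} {1} {v} {q * 2} ratio-1 c₁≐ (≤-reflexive (eq (q * 2)))
      where
      eq : ∀ x → suc (1 * x) ≡ suc x * 1
      eq = solve-∀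

    module _ (Δ n : ℕ) (Δ≥Δ₀ : Δ₀ ≤ Δ) (n≥ : c₀ ^ (2 * Δ) ℚ.≤ fromℕ n) where

      open ≤-Reasoning
      instance
        c₀≢0 : ℚ.NonZero c₀
        c₀≢0 = 1<p<q⇒q-nonZero 1<c₁ c₁<c₀

      k = ⌊ c₀ ^ Δ ⌋ℕ
      s = Δ / w

      c₀^Δ≐ : Ratio (c₀ ^ Δ) (suc q ^ℕ Δ) (q ^ℕ Δ)
      c₀^Δ≐ = ratio-^ {c₀} {suc q} {q} Δ c₀≐

      1≤c₀^Δ : 1ℚ ℚ.≤ c₀ ^ Δ
      1≤c₀^Δ = ratio-mono-≤ {1ℚ} {c₀ ^ Δ} {1} {1} {suc q ^ℕ Δ} {q ^ℕ Δ} {{_}} {{m^n≢0 q Δ}} ratio-1 c₀^Δ≐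
        (≤-trans (≤-reflexive (*-identityˡ (q ^ℕ Δ))) (≤-trans (^-monoˡ-≤ Δ (n≤1+n q)) (≤-reflexive (sym (*-identityʳ (suc q ^ℕ Δ))))))

      0<k : 0 < k
      0<k = proj₁ (⌊⌋ℕ-bounds {c₀ ^ Δ} 1≤c₀^Δ)

      kq^Δ≤ : k * q ^ℕ Δ ≤ suc q ^ℕ Δ
      kq^Δ≤ = ≤-trans (ratio-cancel-≤ {fromℕ k} {c₀ ^ Δ} {k} {1} {suc q ^ℕ Δ} {q ^ℕ Δ} (ratio-fromℕ k) c₀^Δ≐ (proj₂ (⌊⌋ℕ-bounds {c₀ ^ Δ} 1≤c₀^Δ)))
                      (≤-reflexive (*-identityʳ _))

      kk≤n : k * k ≤ n
      kk≤n = *-cancelʳ-≤ _ _ (q ^ℕ (2 * Δ)) {{m^n≢0 q (2 * Δ)}} (begin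
        k * k * q ^ℕ (2 * Δ) ≡⟨ [k*q^t]² k q Δ ⟨
        (k * q ^ℕ Δ) * (k * q ^ℕ Δ) ≤⟨ *-mono-≤ kq^Δ≤ kq^Δ≤ ⟩
        suc q ^ℕ Δ * suc q ^ℕ Δ ≡⟨ ^-double (suc q) Δ ⟨
        suc q ^ℕ (2 * Δ) ≡⟨ *-identityʳ _ ⟨
        suc q ^ℕ (2 * Δ) * 1 ≤⟨ ratio-cancel-≤ {c₀ ^ (2 * Δ)} {fromℕ n} {suc q ^ℕ (2 * Δ)} {q ^ℕ (2 * Δ)} {n} {1}
                                  (ratio-^ {c₀} {suc q} {q} (2 * Δ) c₀≐) (ratio-fromℕ n) n≥ ⟩
        n * q ^ℕ (2 * Δ) ∎)

      0<n : 0 < n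
      0<n = ≤-trans (*-mono-≤ 0<k 0<k) kk≤n

      [1+k]²≤4k² : suc k * suc k ≤ 4 * (k * k)
      [1+k]²≤4k² = ≤-trans (*-mono-≤ 1+k≤ 1+k≤) (≤-reflexive (eq k))
        where
        1+k≤ : suc k ≤ k + k
        1+k≤ = +-monoˡ-≤ k 0<k
        eq : ∀ k → (k + k) * (k + k) ≡ 4 * (k * k)
        eq = solve-∀

      s-large : 64 * suc w ≤ s
      s-large = begin
        64 * suc w ≡⟨ m*n/n≡m (64 * suc w) w ⟨
        64 * suc w * w / w ≤⟨ /-monoˡ-≤ w (m+n≤o⇒m≤o (64 * suc w * w) Δ≥Δ₀) ⟩
        Δ / w ∎

      Δ≤[1+s]w : Δ ≤ suc s * w
      Δ≤[1+s]w = ≤-trans (≤-reflexive (m≡m%n+[m/n]*n Δ w)) (+-monoˡ-≤ (s * w) (<⇒≤ (m%n<n Δ w)))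

      few : 16 * (suc k * suc k) * r ^ℕ s < suc r ^ℕ s
      few = begin-strict
        16 * (suc k * suc k) * r ^ℕ s ≤⟨ *-monoˡ-≤ (r ^ℕ s) (*-monoʳ-≤ 16 [1+k]²≤4k²) ⟩
        16 * (4 * (k * k)) * r ^ℕ s ≡⟨ cong (_* r ^ℕ s) (*-assoc 16 4 (k * k)) ⟨
        64 * (k * k) * r ^ℕ s <⟨ few-partitions r k s
          (subst (λ w → 64 * suc w ≤ s) w≡ s-large)
          (subst (λ w → k * k * w ^ℕ suc s ≤ suc w ^ℕ suc s) w≡ (parts-bound w k s Δ≤[1+s]w kq^Δ≤)) ⟩
        suc r ^ℕ s ∎

      part-small : ∀ p → fromℕ p ℚ.≤ (c₁ ℚ.÷ c₀) ^ Δ ℚ.* fromℕ n → 20 * p ≤ n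
      part-small p p≤ = *-cancelʳ-≤ _ _ (suc v ^ℕ Δ) {{m^n≢0 (suc v) Δ}} (begin
        20 * p * suc v ^ℕ Δ ≡⟨ eq₁ p (suc v ^ℕ Δ) ⟩
        20 * (p * (suc v ^ℕ Δ * 1)) ≤⟨ *-monoʳ-≤ 20 (ratio-cancel-≤ {fromℕ p} {(c₁ ℚ.÷ c₀) ^ Δ ℚ.* fromℕ n} {p} {1} {v ^ℕ Δ * n} {suc v ^ℕ Δ * 1}
            (ratio-fromℕ p)
            (ratio-* {(c₁ ℚ.÷ c₀) ^ Δ} {fromℕ n} {v ^ℕ Δ} {suc v ^ℕ Δ} {n} {1}
              (ratio-^ {c₁ ℚ.÷ c₀} {v} {suc v} Δ (ratio-÷ {c₁} {c₀} {v} {q * 2} {suc v} c₁≐ c₀≐′)) (ratio-fromℕ n)) p≤) ⟩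
        20 * (v ^ℕ Δ * n * 1) ≡⟨ eq₂ (v ^ℕ Δ) n ⟩
        n * (20 * v ^ℕ Δ) ≤⟨ *-monoʳ-≤ n (power-small v Δ (m+n≤o⇒n≤o (64 * suc w * w) Δ≥Δ₀)) ⟩
        n * suc v ^ℕ Δ ∎)
        where
        eq₁ : ∀ p a → 20 * p * a ≡ 20 * (p * (a * 1))
        eq₁ = solve-∀
        eq₂ : ∀ a n → 20 * (a * n * 1) ≡ n * (20 * a)
        eq₂ = solve-∀

      D-small : ∀ d → fromℕ d ℚ.≤ (+ 2 ℚ./ 100) ℚ.* fromℕ n → 50 * d ≤ n
      D-small d d≤ = *-cancelˡ-≤ 2 (begin
        2 * (50 * d) ≡⟨ eq₁ d ⟩
        d * (100 * 1) ≤⟨ ratio-cancel-≤ {fromℕ d} {(+ 2 ℚ./ 100) ℚ.* fromℕ n} {d} {1} {2 * n} {100 * 1} (ratio-fromℕ d)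
                           (ratio-* {+ 2 ℚ./ 100} {fromℕ n} {2} {100} {n} {1} (/-ratio 2 100) (ratio-fromℕ n)) d≤ ⟩
        2 * n * 1 ≡⟨ *-identityʳ (2 * n) ⟩
        2 * n ∎)
        where
        eq₁ : ∀ d → 2 * (50 * d) ≡ d * (100 * 1)
        eq₁ = solve-∀

      subset-large : ∀ p → (+ 1 ℚ./ 100) ℚ.* fromℕ n ℚ.≤ fromℕ p → n ≤ 100 * p
      subset-large p ≤p = begin
        n ≡⟨ eq₁ n ⟩
        1 * n * 1 ≤⟨ ratio-cancel-≤ {(+ 1 ℚ./ 100) ℚ.* fromℕ n} {fromℕ p} {1 * n} {100 * 1} {p} {1}
                       (ratio-* {+ 1 ℚ./ 100} {fromℕ n} {1} {100} {n} {1} (/-ratio 1 100) (ratio-fromℕ n)) (ratio-fromℕ p) ≤p ⟩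
        p * (100 * 1) ≡⟨ *-comm p 100 ⟩
        100 * p ∎
        where
        eq₁ : ∀ n → n ≡ 1 * n * 1
        eq₁ = solve-∀

      crossSum-bound : ∀ C → 9 * (n * n) ≤ 10 * C →
        (+ 55 ℚ./ 100) ℚ.* ((+ 98 ℚ./ 100) ℚ.* fromℕ n) ^ 2 ℚ.< fromℕ C
      crossSum-bound C 9n²≤10C = ratio-mono-< {(+ 55 ℚ./ 100) ℚ.* ((+ 98 ℚ./ 100) ℚ.* fromℕ n) ^ 2} {fromℕ C}
        {55 * (98 * n) ^ℕ 2} {100 * (100 * 1) ^ℕ 2} {C} {1}
        (ratio-* {+ 55 ℚ./ 100} {((+ 98 ℚ./ 100) ℚ.* fromℕ n) ^ 2} {55} {100} {(98 * n) ^ℕ 2} {(100 * 1) ^ℕ 2} (/-ratio 55 100)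
          (ratio-^ {(+ 98 ℚ./ 100) ℚ.* fromℕ n} {98 * n} {100 * 1} 2
            (ratio-* {+ 98 ℚ./ 100} {fromℕ n} {98} {100} {n} {1} (/-ratio 98 100) (ratio-fromℕ n))))
        (ratio-fromℕ C)
        (cross-bound 55 98 100 100000 n C 0<n (toWitness {a? = 55 * (98 * 98) <? 100000 * 9} tt) refl 9n²≤10C)

      0<Δ : 0 < Δ
      0<Δ = ≤-trans (≤-trans (s≤s z≤n) (m≤n+m (19 * suc v) (64 * suc w * w))) Δ≥Δ₀

      Expanding : BipartiteGraph n n → Set
      Expanding H =
          maxDegree H ≤ Δ
          × ((𝒳 𝒴 : Partition k n) →
              (∀ i → fromℕ ∣ part 𝒳 i ∣ ℚ.≤ (c₁ ℚ.÷ c₀) ^ Δ ℚ.* fromℕ n) →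
              (∀ i → fromℕ ∣ part 𝒴 i ∣ ℚ.≤ (c₁ ℚ.÷ c₀) ^ Δ ℚ.* fromℕ n) →
              fromℕ ∣ D 𝒳 ∣ ℚ.≤ (+ 2 ℚ./ 100) ℚ.* fromℕ n →
              fromℕ ∣ D 𝒴 ∣ ℚ.≤ (+ 2 ℚ./ 100) ℚ.* fromℕ n →
              fromℕ (crossSum H 𝒳 𝒴) ℚ.> (+ 55 ℚ./ 100) ℚ.* ((+ 98 ℚ./ 100) ℚ.* fromℕ n) ^ 2)
          × ((X′ Y′ : Subset n) →
              fromℕ ∣ X′ ∣ ℚ.≥ (+ 1 ℚ./ 100) ℚ.* fromℕ n →
              fromℕ ∣ Y′ ∣ ℚ.≥ (+ 1 ℚ./ 100) ℚ.* fromℕ n →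
              e H X′ Y′ > 0)

      expanding : ∀ H → maxDegree H ≤ Δ × HitsBlocks H c (suc k) → Expanding H
      expanding H (degrees , hits) = degrees ,
        (λ 𝒳 𝒴 _ smallʸ Dˣ Dʸ → crossSum-bound (crossSum H 𝒳 𝒴)
          (crossSum-large H 𝒳 𝒴 (≤-trans (toWitness {a? = 100 ≤? 10000} tt) 10000≤c) hits
            (λ i → part-small ∣ part 𝒴 i ∣ (smallʸ i)) (D-small ∣ D 𝒳 ∣ Dˣ) (D-small ∣ D 𝒴 ∣ Dʸ))) ,
        (λ X′ Y′ largeˣ largeʸ → e-large {d = 100} H 0<k 10000≤c hits X′ Y′
          (subset-large ∣ X′ ∣ largeˣ) (subset-large ∣ Y′ ∣ largeʸ))

      construction : Σ[ H ∈ BipartiteGraph n n ] Expanding H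
      construction =
        map₂ (λ {H} → expanding H) (∃-hitting-graph c r Δ s (suc k) 0<n 0<Δ 2c≡1+r (m/n*n≤m Δ w)
          (≤-trans [1+k]²≤4k² (*-monoʳ-≤ 4 kk≤n)) few)

open import Data.Nat.Properties using (≤-refl)
open import Data.Product.Base using (_,_)
open import Data.Rational.Base using (_/_; _÷_; _*_; _≤_; _<_; _≥_; _>_)
open import Relation.Binary.PropositionalEquality using (refl)

lemma3p2 :
  Σ[ c₀ ∈ ℚ ] Σ[ c₁ ∈ ℚ ] Σ[ c₁<c₀ ∈ c₁ < c₀ ] Σ[ 1<c₁ ∈ 1ℚ < c₁ ] Σ[ Δ₀ ∈ ℕ ]
  ((Δ n : ℕ) → Δ ℕ.≥ Δ₀ → fromℕ n ≥ c₀ ^ (2 ℕ.* Δ) →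
    let instance c₀≢0 = 1<p<q⇒q-nonZero 1<c₁ c₁<c₀
        k = ⌊ c₀ ^ Δ ⌋ℕ
    in
    Σ[ H ∈ BipartiteGraph n n ]
      maxDegree H ℕ.≤ Δ
      × ((𝒳 𝒴 : Partition k n) →
          (∀ i → fromℕ ∣ part 𝒳 i ∣ ≤ (c₁ ÷ c₀) ^ Δ * fromℕ n) →
          (∀ i → fromℕ ∣ part 𝒴 i ∣ ≤ (c₁ ÷ c₀) ^ Δ * fromℕ n) →
          fromℕ ∣ D 𝒳 ∣ ≤ (+ 2 / 100) * fromℕ n →
          fromℕ ∣ D 𝒴 ∣ ≤ (+ 2 / 100) * fromℕ n →
          fromℕ (crossSum H 𝒳 𝒴) > (+ 55 / 100) * ((+ 98 / 100) * fromℕ n) ^ 2)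
      × ((X′ Y′ : Subset n) →
          fromℕ ∣ X′ ∣ ≥ (+ 1 / 100) * fromℕ n →
          fromℕ ∣ Y′ ∣ ≥ (+ 1 / 100) * fromℕ n →
          e H X′ Y′ ℕ.> 0))
lemma3p2 = K.c₀ , K.c₁ , K.c₁<c₀ , K.1<c₁ , K.Δ₀ , K.construction
  where
  module K = Proof.Construction 10000 19999 refl ≤-refl
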